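{- Let $k$ be a positive integer. Every simple permutation of length at least $2(2048k^8)^{(2048k^8)^{2k}}$ contains a proper pin sequence of length $2k$, a parallel alternation of length $2k$, or a wedge simple permutation of length $2k$.
   Context: An interval of a permutation $\pi$ of $[n]$ is a set of contiguous indices $I$ with $\pi(I)$ a set of consecutive integers; $\pi$ is simple if its only intervals have size $0$, $1$ or $n$. A permutation contains $\sigma$ if it has a subsequence order isomorphic to $\sigma$. Pin sequences are taken in the plot $\{(i,\pi(i)):i\in[n]\}$. For points $q_1,\dots,q_m$, $\operatorname{rect}(q_1,\dots,q_m)$ is the smallest closed axes-parallel rectangle containing them. A pin sequence (of length $m$) is a sequence of distinct points $p_1,\dots,p_m$ of the plot such that for each $i\ge3$, writing $\operatorname{rect}(p_1,\dots,p_{i-1})=[a,b]\times[c,d]$ and $p_i=(x,y)$: $p_i\notin\operatorname{rect}(p_1,\dots,p_{i-1})$ and either $a<x<b$ or $c<y<d$. Such $p_i$ is a left pin if $x<a$, right pin if $x>b$, up pin if $y>d$, down pin if $y<c$. The pin sequence is proper if (maximality) each $p_i$, $i\ge3$, is extreme in its direction among all points of the plot that could serve as a pin of that direction for $\operatorname{rect}(p_1,\dots,p_{i-1})$ (e.g. for a right pin $p_i=(x,y)$ there is no point of the plot in $(x,n]\times[c,d]$), and (separation) for each $i\ge2$ with $i+1\le m$, $p_{i+1}$ lies horizontally or vertically strictly between $\operatorname{rect}(p_1,\dots,p_{i-1})$ and $p_i$. A horizontal alternation is a permutation in which every entry with odd value lies to the left of every entry with even value, or the reverse of such; a vertical alternation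 is the inverse of a horizontal alternation, equivalently a permutation whose entries in odd positions are all smaller, or all larger, than its entries in even positions. A vertical alternation is parallel if its odd-position entries and even-position entries are both increasing or both decreasing; a horizontal alternation is parallel if its inverse is. Wedge simple permutations: a permutation $\tau$ of length $\ell\ge4$ is a basic type 1 wedge simple permutation if, among $\tau(1),\dots,\tau(\ell-1)$, the entries in odd positions are increasing, those in even positions are decreasing, every odd-position entry exceeds every even-position entry, and $\tau(\ell)$ is larger than all even-position entries and smaller than all odd-position entries among $\tau(1),\dots,\tau(\ell-1)$ (e.g. $7\,5\,8\,4\,9\,3\,10\,2\,11\,1\,12\,6$). A permutation $\tau$ of even length $\ell\ge4$ is a basic type 2 wedge simple permutation if $\tau(2)=\ell$, $\tau(3),\tau(5),\dots,\tau(\ell-1)$ are decreasing, $\tau(4),\tau(6),\dots,\tau(\ell)$ are increasing, and every $\tau(2j+1)$ ($j\ge1$) is less than $\tau(1)$, which is less than every $\tau(2j)$ ($j\ge2$) (e.g. $6\,12\,5\,7\,4\,8\,3\,9\,2\,10\,1\,11$). A wedge simple permutation is any permutation obtained from a basic type 1 or basic type 2 one by any composition of reversal, complementation ($\tau(i)\mapsto\ell+1-\tau(i)$) and inversion. -}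

module Defs where

open import Data.Nat using (ℕ; zero; suc; _+_; _*_; _∸_; _^_; _≤_; _<_)
open import Data.Fin using (Fin; toℕ; opposite)
open import Data.Product using (Σ; ∃; _×_; _,_)
open import Data.Sum using (_⊎_)
open import Relation.Nullary using (¬_)
open import Relation.Binary.PropositionalEquality using (_≡_)
open import Function.Definitions using (Injective)

-- A permutation of [n] is represented (0-based) by an injective map Fin n → Fin n.
-- Index i : Fin n stands for position toℕ i + 1, value v for value toℕ v + 1.

IsPerm : {n : ℕ} → (Fin n → Fin n) → Set
IsPerm π = Injective _≡_ _≡_ π

IsInterval : {n : ℕ} → (Fin n → Fin n) → Fin n → Fin n → Set
IsInterval π i j =
  ∀ (t u : Fin _) → toℕ i ≤ toℕ t → toℕ t ≤ toℕ j → toℕ i ≤ toℕ u → toℕ u ≤ toℕ j →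
  ∀ (v : Fin _) → toℕ (π t) ≤ toℕ v → toℕ v ≤ toℕ (π u) →
  ∃ λ (s : Fin _) → toℕ i ≤ toℕ s × toℕ s ≤ toℕ j × π s ≡ v

Simple : {n : ℕ} → (Fin n → Fin n) → Set
Simple {n} π = ∀ (i j : Fin n) → toℕ i ≤ toℕ j → IsInterval π i j →
  (suc (toℕ j) ∸ toℕ i ≡ 1) ⊎ (suc (toℕ j) ∸ toℕ i ≡ n)

Contains : {n m : ℕ} → (Fin n → Fin n) → (Fin m → Fin m) → Set
Contains {n} {m} π σ = ∃ λ (e : Fin m → Fin n) →
  (∀ a b → toℕ a < toℕ b → toℕ (e a) < toℕ (e b)) ×
  (∀ a b → (toℕ (σ a) < toℕ (σ b) → toℕ (π (e a)) < toℕ (π (e b))) ×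
           (toℕ (π (e a)) < toℕ (π (e b)) → toℕ (σ a) < toℕ (σ b)))

-- Pin sequences.  The point of index q : Fin n is (X q, Y q) = (q, π q).
-- A pin sequence of length m is an injective p : Fin m → Fin n.
-- "Earlier" means index j of the sequence with toℕ j < toℕ i, so the
-- points p j with toℕ j < toℕ i are p_1,...,p_{i-1} (1-based), whose
-- bounding rectangle is [a,b]×[c,d].

module Pins {n m : ℕ} (π : Fin n → Fin n) (p : Fin m → Fin n) where

  X : Fin n → ℕ
  X q = toℕ q

  Y : Fin n → ℕ
  Y q = toℕ (π q)

  InXRange : Fin m → Fin n → Set
  InXRange i q = (∃ λ j → toℕ j < toℕ i × X (p j) ≤ X q) × (∃ λ j → toℕ j < toℕ i × X q ≤ X (p j))

  InYRange : Fin m → Fin n → Set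
  InYRange i q = (∃ λ j → toℕ j < toℕ i × Y (p j) ≤ Y q) × (∃ λ j → toℕ j < toℕ i × Y q ≤ Y (p j))

  StrictXBand : Fin m → Fin n → Set
  StrictXBand i q = (∃ λ j → toℕ j < toℕ i × X (p j) < X q) × (∃ λ j → toℕ j < toℕ i × X q < X (p j))

  StrictYBand : Fin m → Fin n → Set
  StrictYBand i q = (∃ λ j → toℕ j < toℕ i × Y (p j) < Y q) × (∃ λ j → toℕ j < toℕ i × Y q < Y (p j))

  InRect : Fin m → Fin n → Set
  InRect i q = InXRange i q × InYRange i q

  LeftOf : Fin m → Fin n → Set
  LeftOf i q = ∀ j → toℕ j < toℕ i → X q < X (p j)
  RightOf : Fin m → Fin n → Set
  RightOf i q = ∀ j → toℕ j < toℕ i → X (p j) < X q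
  Above : Fin m → Fin n → Set
  Above i q = ∀ j → toℕ j < toℕ i → Y (p j) < Y q
  Below : Fin m → Fin n → Set
  Below i q = ∀ j → toℕ j < toℕ i → Y q < Y (p j)

  PinCondition : Set
  PinCondition = ∀ (i : Fin m) → 2 ≤ toℕ i →
    ¬ InRect i (p i) × (StrictXBand i (p i) ⊎ StrictYBand i (p i))

  Maximality : Set
  Maximality = ∀ (i : Fin m) → 2 ≤ toℕ i →
    (RightOf i (p i) → ∀ q → X (p i) < X q → ¬ InYRange i q) ×
    (LeftOf  i (p i) → ∀ q → X q < X (p i) → ¬ InYRange i q) ×
    (Above   i (p i) → ∀ q → Y (p i) < Y q → ¬ InXRange i q) ×
    (Below   i (p i) → ∀ q → Y q < Y (p i) → ¬ InXRange i q)

  BetweenH : Fin m → Fin n → Set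
  BetweenH i q = (RightOf i q × X q < X (p i)) ⊎ (LeftOf i q × X (p i) < X q)

  BetweenV : Fin m → Fin n → Set
  BetweenV i q = (Above i q × Y q < Y (p i)) ⊎ (Below i q × Y (p i) < Y q)

  Separation : Set
  Separation = ∀ (i i' : Fin m) → 1 ≤ toℕ i → toℕ i' ≡ suc (toℕ i) →
    BetweenH i (p i') ⊎ BetweenV i (p i')

  IsProperPinSequence : Set
  IsProperPinSequence = Injective _≡_ _≡_ p × PinCondition × Maximality × Separation

HasProperPinSequence : {n : ℕ} → (Fin n → Fin n) → ℕ → Set
HasProperPinSequence {n} π m = ∃ λ (p : Fin m → Fin n) → Pins.IsProperPinSequence π p

-- Parity.  Position toℕ i + 1 is odd iff toℕ i is even.

EvenN : ℕ → Set
EvenN a = ∃ λ j → a ≡ 2 * j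

OddN : ℕ → Set
OddN a = ∃ λ j → a ≡ suc (2 * j)

OddPos : {ℓ : ℕ} → Fin ℓ → Set
OddPos i = EvenN (toℕ i)

EvenPos : {ℓ : ℕ} → Fin ℓ → Set
EvenPos i = OddN (toℕ i)

-- same conventions for values
OddVal : {ℓ : ℕ} → Fin ℓ → Set
OddVal v = EvenN (toℕ v)

EvenVal : {ℓ : ℕ} → Fin ℓ → Set
EvenVal v = OddN (toℕ v)

IncreasingOn : {ℓ : ℕ} → (Fin ℓ → Set) → (Fin ℓ → Fin ℓ) → Set
IncreasingOn P σ = ∀ i j → P i → P j → toℕ i < toℕ j → toℕ (σ i) < toℕ (σ j)

DecreasingOn : {ℓ : ℕ} → (Fin ℓ → Set) → (Fin ℓ → Fin ℓ) → Set
DecreasingOn P σ = ∀ i j → P i → P j → toℕ i < toℕ j → toℕ (σ j) < toℕ (σ i)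

VerticalAlternation : {ℓ : ℕ} → (Fin ℓ → Fin ℓ) → Set
VerticalAlternation σ =
  (∀ i j → OddPos i → EvenPos j → toℕ (σ i) < toℕ (σ j)) ⊎
  (∀ i j → OddPos i → EvenPos j → toℕ (σ j) < toℕ (σ i))

HorizontalAlternation : {ℓ : ℕ} → (Fin ℓ → Fin ℓ) → Set
HorizontalAlternation σ =
  (∀ i j → OddVal (σ i) → EvenVal (σ j) → toℕ i < toℕ j) ⊎
  (∀ i j → OddVal (σ i) → EvenVal (σ j) → toℕ j < toℕ i)

ParallelVerticalAlternation : {ℓ : ℕ} → (Fin ℓ → Fin ℓ) → Set
ParallelVerticalAlternation σ = VerticalAlternation σ ×
  ((IncreasingOn OddPos σ × IncreasingOn EvenPos σ) ⊎
   (DecreasingOn OddPos σ × DecreasingOn EvenPos σ))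

IsInverse : {ℓ : ℕ} → (Fin ℓ → Fin ℓ) → (Fin ℓ → Fin ℓ) → Set
IsInverse τ σ = (∀ i → τ (σ i) ≡ i) × (∀ v → σ (τ v) ≡ v)

ParallelHorizontalAlternation : {ℓ : ℕ} → (Fin ℓ → Fin ℓ) → Set
ParallelHorizontalAlternation σ = HorizontalAlternation σ ×
  ∃ λ τ → IsInverse τ σ × ParallelVerticalAlternation τ

ParallelAlternation : {ℓ : ℕ} → (Fin ℓ → Fin ℓ) → Set
ParallelAlternation σ = ParallelVerticalAlternation σ ⊎ ParallelHorizontalAlternation σ

BasicType1 : {ℓ : ℕ} → (Fin ℓ → Fin ℓ) → Set
BasicType1 {ℓ} τ = IsPerm τ × 4 ≤ ℓ ×
  (∀ i j → toℕ i < ℓ ∸ 1 → toℕ j < ℓ ∸ 1 → OddPos i → OddPos j →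
     toℕ i < toℕ j → toℕ (τ i) < toℕ (τ j)) ×
  (∀ i j → toℕ i < ℓ ∸ 1 → toℕ j < ℓ ∸ 1 → EvenPos i → EvenPos j →
     toℕ i < toℕ j → toℕ (τ j) < toℕ (τ i)) ×
  (∀ i j → toℕ i < ℓ ∸ 1 → toℕ j < ℓ ∸ 1 → OddPos i → EvenPos j →
     toℕ (τ j) < toℕ (τ i)) ×
  (∀ last i → toℕ last ≡ ℓ ∸ 1 → toℕ i < ℓ ∸ 1 →
     (OddPos i → toℕ (τ last) < toℕ (τ i)) × (EvenPos i → toℕ (τ i) < toℕ (τ last)))

BasicType2 : {ℓ : ℕ} → (Fin ℓ → Fin ℓ) → Set
BasicType2 {ℓ} τ = IsPerm τ × 4 ≤ ℓ × EvenN ℓ ×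
  (∀ i → toℕ i ≡ 1 → toℕ (τ i) ≡ ℓ ∸ 1) ×
  (∀ i j → 2 ≤ toℕ i → 2 ≤ toℕ j → OddPos i → OddPos j →
     toℕ i < toℕ j → toℕ (τ j) < toℕ (τ i)) ×
  (∀ i j → 3 ≤ toℕ i → 3 ≤ toℕ j → EvenPos i → EvenPos j →
     toℕ i < toℕ j → toℕ (τ i) < toℕ (τ j)) ×
  (∀ first i → toℕ first ≡ 0 →
     (2 ≤ toℕ i → OddPos i → toℕ (τ i) < toℕ (τ first)) ×
     (3 ≤ toℕ i → EvenPos i → toℕ (τ first) < toℕ (τ i)))

data WedgeSimple {ℓ : ℕ} : (Fin ℓ → Fin ℓ) → Set where
  basic1 : ∀ {τ} → BasicType1 τ → WedgeSimple τ
  basic2 : ∀ {τ} → BasicType2 τ → WedgeSimple τ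
  reverse : ∀ {τ τ'} → WedgeSimple τ → (∀ i → τ' i ≡ τ (opposite i)) → WedgeSimple τ'
  complement : ∀ {τ τ'} → WedgeSimple τ → (∀ i → τ' i ≡ opposite (τ i)) → WedgeSimple τ'
  inverse : ∀ {τ τ'} → WedgeSimple τ → IsInverse τ' τ → WedgeSimple τ'

bound : ℕ → ℕ
bound k = 2 * (2048 * k ^ 8) ^ ((2048 * k ^ 8) ^ (2 * k))

{-# OPTIONS --safe #-}
-- Take the pairs of points in positions 2j+1, 2j+2. Simplicity gives each pair a proper pin sequence that starts with
-- it and ends at the rightmost point; we may assume that all of these have fewer than 2k points. Read backwards from
-- their common end they form a tree of bounded depth with many leaves, so at some point x many sequences with
-- distinct predecessors y of x merge, and they agree after x. As x separates each y from the earlier points of its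
-- sequence, the y lie on one side of x and those earlier points on the other; as every y is an extreme pin (or its
-- pair is adjacent), two consecutive y always have an earlier point between them. This is a long zigzag, and by
-- Ramsey's theorem it can be made parallel or a wedge. A wedge opening towards x is completed by x to a wedge simple
-- permutation of type 1. A wedge closing towards x is completed to type 2 by the common pin after x, or, if x is the
-- rightmost point, by following a pin sequence from the tip of the wedge to the leftmost point: one of its pins has to
-- pass k rungs of the wedge at once, and this pin completes the wedge to type 1 or 2.

module Submission where

open import Defs
open import Data.Nat using (ℕ; zero; suc; _+_; _*_; _∸_; _^_; _≤_; _<_; z≤n; s≤s; s≤s⁻¹)
import Data.Nat as ℕ
import Data.Nat.Properties as ℕₚ
open import Data.Nat.Solver using (module +-*-Solver)
open import Data.Fin using (Fin; toℕ; fromℕ; fromℕ<; opposite; punchOut)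
import Data.Fin.Properties as Finₚ
open import Data.Bool using (Bool; true; false; not)
import Data.Bool.Properties as Boolₚ
open import Data.List using (List; []; _∷_; length; filter; map; allFin; upTo)
open import Data.List.Properties using (length-map; length-tabulate; length-applyUpTo; filter-notAll)
open import Data.List.Relation.Unary.All using (All; []; _∷_)
import Data.List.Relation.Unary.All as All
import Data.List.Relation.Unary.All.Properties as Allₚ
open import Data.List.Relation.Unary.Any using (Any; here; there)
import Data.List.Relation.Unary.Any as Any
open import Data.List.Relation.Unary.AllPairs using (AllPairs; []; _∷_)
import Data.List.Relation.Unary.AllPairs as AllPairs
import Data.List.Relation.Unary.AllPairs.Properties as AllPairsₚ
open import Data.List.Relation.Unary.Unique.Propositional.Properties using (allFin⁺)
open import Data.List.Membership.Propositional using (_∈_; find; lose)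
open import Data.List.Membership.Propositional.Properties using (∈-map⁻; ∈-allFin; ∈-filter⁺; ∈-filter⁻; ∈-upTo⁺)
open import Data.List.Relation.Binary.Sublist.Propositional using (_⊆_; []; _∷_; _∷ʳ_; ⊆-trans; minimum)
open import Data.List.Relation.Binary.Sublist.Propositional.Properties using (All-resp-⊆) renaming (map⁺ to ⊆-map⁺)
open import Data.Product using (∃; ∃₂; _×_; _,_; proj₁; proj₂)
open import Data.Product.Properties using (≡-dec)
open import Data.Sum using (_⊎_; inj₁; inj₂)
open import Data.Empty using (⊥; ⊥-elim)
open import Function using (_∘_; id)
open import Function.Definitions using (Injective)
open import Relation.Nullary using (¬_; Dec; yes; no; does)
open import Relation.Nullary.Decidable using (_×-dec_)
open import Relation.Unary using (Decidable)
open import Relation.Binary using (DecidableEquality; tri<; tri≈; tri>)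
open import Relation.Binary.PropositionalEquality using (_≡_; _≢_; refl; sym; trans; cong; cong₂; subst; subst₂)

-- The pairs are adjacent because a two-point start has no extremality to appeal to: adjacency
-- replaces it when two merging sequences consist of their pairs alone. Sequences of one common
-- length are selected, so that reading them backwards keeps them at the same stage. During the
-- descent only the pin right after the current point is remembered. It is enough to complete a
-- closing wedge; the rightmost point, which has no next pin, is the one case that calls for a
-- second pin sequence. Every configuration occurs in eight orientations. They are treated at once
-- by an order `Lt` that takes an axis and a sign: changes of sign are reversal and complement, the
-- exchange of the axes is inversion. Constants: 4 colours in Ramsey's theorem; k rungs for each of
-- fewer than 2k pins, hence 2k² + 2 rungs; 8 orientations of a separating pin; a tree of depth
-- below 2k. Together they ask for fewer than 2 to the power 2 + 58k + 48k³ pairs, and this is what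
-- is compared with the bound.

AllPairs-resp-⊆ : {A : Set} {R : A → A → Set} {xs ys : List A} → xs ⊆ ys → AllPairs R ys → AllPairs R xs
AllPairs-resp-⊆ [] [] = []
AllPairs-resp-⊆ (_ ∷ʳ s) (_ ∷ ps) = AllPairs-resp-⊆ s ps
AllPairs-resp-⊆ (refl ∷ s) (p ∷ ps) = All-resp-⊆ s p ∷ AllPairs-resp-⊆ s ps

-- Partitions and the pigeonhole principle

partition-⊆ : {A : Set} {P : A → Set} → Decidable P → (xs : List A) →
  ∃₂ λ ys zs → ys ⊆ xs × zs ⊆ xs × All P ys × All (¬_ ∘ P) zs × length ys + length zs ≡ length xs
partition-⊆ P? [] = [] , [] , [] , [] , [] , [] , refl
partition-⊆ P? (x ∷ xs) with P? x | partition-⊆ P? xs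
... | yes p | ys , zs , s , t , a , b , e = x ∷ ys , zs , refl ∷ s , x ∷ʳ t , p ∷ a , b , cong suc e
... | no ¬p | ys , zs , s , t , a , b , e =
  ys , x ∷ zs , x ∷ʳ s , refl ∷ t , a , ¬p ∷ b , trans (ℕₚ.+-suc (length ys) (length zs)) (cong suc e)

<-+-cancel-≤ : ∀ {a b c d} → a + b < c + d → c ≤ a → b < d
<-+-cancel-≤ {a} {b} {c} {d} lt le = ℕₚ.+-cancelˡ-< a b d (ℕₚ.<-≤-trans lt (ℕₚ.+-monoˡ-≤ d le))

module _ {A K : Set} (_≟_ : DecidableEquality K) (f : A → K) where

  constant-sublist : ∀ (ks : List K) c xs → All (λ x → f x ∈ ks) xs → length ks * c < length xs →
    ∃₂ λ k ys → ys ⊆ xs × All (λ y → f y ≡ k) ys × c < length ys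
  constant-sublist [] c (x ∷ xs) (() ∷ _) lt
  constant-sublist (k ∷ ks) c xs f∈ lt
    with partition-⊆ (λ x → f x ≟ k) xs
  ... | ys , zs , s , t , a , b , e with c ℕₚ.<? length ys
  ...   | yes c< = k , ys , s , a , c<
  ...   | no c≮
    with constant-sublist ks c zs (All.zipWith drop-head (b , All-resp-⊆ t f∈))
           (<-+-cancel-≤ {c} (subst (c + length ks * c <_) (sym e) lt) (ℕₚ.≮⇒≥ c≮))
    where
    drop-head : ∀ {x} → (f x ≢ k) × f x ∈ k ∷ ks → f x ∈ ks
    drop-head (ne , here eq) = ⊥-elim (ne eq)
    drop-head (ne , there m) = m
  ...     | k' , ws , u , a' , c< = k' , ws , ⊆-trans u t , a' , c<

  -- Greedy choice: either the class of the head is large, or it is discarded at the cost of at most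
  -- `c` entries and the head stays as the representative of its value.
  distinct-or-constant-sublist : ∀ b c xs → b * c < length xs →
    (∃ λ ys → ys ⊆ xs × AllPairs (λ y z → f y ≢ f z) ys × b ≡ length ys) ⊎
    (∃₂ λ k ys → ys ⊆ xs × All (λ y → f y ≡ k) ys × c < length ys)
  distinct-or-constant-sublist zero c xs lt = inj₁ ([] , minimum xs , [] , refl)
  distinct-or-constant-sublist (suc b) c (x ∷ xs) lt
    with partition-⊆ (λ y → f y ≟ f x) xs
  ... | ys , zs , s , t , a , d , e with c ℕₚ.<? suc (length ys)
  ...   | yes c< = inj₂ (f x , x ∷ ys , refl ∷ s , refl ∷ a , c<)
  ...   | no c≮
    with distinct-or-constant-sublist b c zs
           (<-+-cancel-≤ {c} (subst (λ l → c + b * c < suc l) (sym e) lt) (ℕₚ.≮⇒≥ c≮))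
  ...     | inj₁ (ws , u , p , eq) =
    inj₁ (x ∷ ws , refl ∷ ⊆-trans u t , All.map (λ ne e → ne (sym e)) (All-resp-⊆ u d) ∷ p , cong suc eq)
  ...     | inj₂ (k , ws , u , p , c<) = inj₂ (k , ws , x ∷ʳ ⊆-trans u t , p , c<)

-- Ramsey's theorem for finite sequences

-- The recursion of the end-homogeneous argument: one entry is spent, and one of `C` colour classes
-- of the others is kept. All length bounds are strict, so the value 0 asks for one entry.
ramsey : ℕ → ℕ → ℕ
ramsey C zero = 0
ramsey C (suc t) = suc (C * ramsey C t)

module _ {A K : Set} (_≟_ : DecidableEquality K) (ks : List K) (complete : ∀ k → k ∈ ks)
         (col : A → A → K) where

  -- In zs every entry is paired with the colour it has with all later entries.
  end-homogeneous : ∀ t xs → ramsey (length ks) t < length xs →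
    ∃ λ (zs : List (A × K)) → map proj₁ zs ⊆ xs × t < length zs ×
      AllPairs (λ y z → col (proj₁ y) (proj₁ z) ≡ proj₂ y) zs
  -- No entry follows the last one, so any colour will do for it.
  end-homogeneous zero (x ∷ xs) lt = (x , col x x) ∷ [] , refl ∷ minimum xs , s≤s z≤n , [] ∷ []
  end-homogeneous (suc t) (x ∷ xs) lt
    with constant-sublist _≟_ (col x) ks (ramsey (length ks) t) xs (All.universal (λ y → complete (col x y)) xs) (s≤s⁻¹ lt)
  ... | k , ys , s , a , lt' with end-homogeneous t ys lt'
  ...   | zs , u , lt'' , p =
    (x , k) ∷ zs , refl ∷ ⊆-trans u s , s≤s lt'' , Allₚ.map⁻ (All-resp-⊆ u a) ∷ p

  -- In an end-homogeneous sequence the first entry of a pair decides its colour, so it remains to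
  -- apply the pigeonhole principle to the colours attached to the entries.
  homogeneous-sublist : ∀ m xs → ramsey (length ks) (length ks * m) < length xs →
    ∃₂ λ k ys → ys ⊆ xs × m < length ys × AllPairs (λ y z → col y z ≡ k) ys
  homogeneous-sublist m xs lt with end-homogeneous (length ks * m) xs lt
  ... | zs , s , lt' , p
    with constant-sublist _≟_ proj₂ ks m zs (All.universal (λ z → complete (proj₂ z)) zs) lt'
  ...   | k , ws , u , a , m< =
    k , map proj₁ ws , ⊆-trans (⊆-map⁺ proj₁ u) s , subst (m <_) (sym (length-map proj₁ ws)) m< ,
    AllPairsₚ.map⁺ (recolour ws a (AllPairs-resp-⊆ u p))
    where
    recolour : ∀ ws → All (λ w → proj₂ w ≡ k) ws →
      AllPairs (λ y z → col (proj₁ y) (proj₁ z) ≡ proj₂ y) ws →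
      AllPairs (λ y z → col (proj₁ y) (proj₁ z) ≡ k) ws
    recolour [] [] [] = []
    recolour (w ∷ ws) (refl ∷ a) (q ∷ qs) = q ∷ recolour ws a qs

-- Sorting and extremal elements

module _ {A : Set} {_≺_ : A → A → Set} (≺-trans : ∀ {x y z} → x ≺ y → y ≺ z → x ≺ z)
         (connex : ∀ x y → x ≢ y → x ≺ y ⊎ y ≺ x) where

  insert-sorted : ∀ x ys → All (x ≢_) ys → AllPairs _≺_ ys →
    ∃ λ zs → AllPairs _≺_ zs × length zs ≡ suc (length ys) × (∀ {z} → z ∈ zs → z ∈ x ∷ ys)
  insert-sorted x [] _ _ = x ∷ [] , [] ∷ [] , refl , id
  insert-sorted x (y ∷ ys) (ne ∷ nes) (p ∷ ps) with connex x y ne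
  ... | inj₁ x≺y = x ∷ y ∷ ys , (x≺y ∷ All.map (≺-trans x≺y) p) ∷ p ∷ ps , refl , id
  ... | inj₂ y≺x with insert-sorted x ys nes ps
  ...   | zs , q , e , m = y ∷ zs , All.tabulate (above ∘ m) ∷ q , cong suc e , m'
    where
    above : ∀ {z} → z ∈ x ∷ ys → y ≺ z
    above (here refl) = y≺x
    above (there i) = All.lookup p i
    m' : ∀ {z} → z ∈ y ∷ zs → z ∈ x ∷ y ∷ ys
    m' (here eq) = there (here eq)
    m' (there i) with m i
    ... | here eq = here eq
    ... | there j = there (there j)

  sort : ∀ xs → AllPairs _≢_ xs →
    ∃ λ ys → AllPairs _≺_ ys × length ys ≡ length xs × (∀ {z} → z ∈ ys → z ∈ xs)
  sort [] [] = [] , [] , refl , id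
  sort (x ∷ xs) (d ∷ ds) with sort xs ds
  ... | ys , p , e , m with insert-sorted x ys (All.tabulate (All.lookup d ∘ m)) p
  ...   | zs , q , e' , m' = zs , q , trans e' (cong suc e) , back ∘ m'
    where
    back : ∀ {z} → z ∈ x ∷ ys → z ∈ x ∷ xs
    back (here eq) = here eq
    back (there i) = there (m i)

module _ {A : Set} {_≺_ : A → A → Set} (≺-trans : ∀ {x y z} → x ≺ y → y ≺ z → x ≺ z)
         (compare : ∀ x y → x ≡ y ⊎ (x ≺ y ⊎ y ≺ x)) where

  greatest : ∀ x xs → ∃ λ m → m ∈ x ∷ xs × All (λ y → y ≡ m ⊎ y ≺ m) (x ∷ xs)
  greatest x [] = x , here refl , inj₁ refl ∷ []
  greatest x (y ∷ ys) with greatest y ys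
  ... | m , m∈ , max with compare x m
  ...   | inj₁ eq = m , there m∈ , inj₁ eq ∷ max
  ...   | inj₂ (inj₁ x≺m) = m , there m∈ , inj₂ x≺m ∷ max
  ...   | inj₂ (inj₂ m≺x) = x , here refl , inj₁ refl ∷ All.map below max
    where
    below : ∀ {z} → z ≡ m ⊎ z ≺ m → z ≡ x ⊎ z ≺ x
    below (inj₁ refl) = inj₂ m≺x
    below (inj₂ z≺m) = inj₂ (≺-trans z≺m m≺x)

-- Indexing into lists; injections between finite sets

nth : {A : Set} → A → List A → ℕ → A
nth d [] i = d
nth d (x ∷ xs) zero = x
nth d (x ∷ xs) (suc i) = nth d xs i

nth-∈ : {A : Set} (d : A) (xs : List A) {i : ℕ} → i < length xs → nth d xs i ∈ xs
nth-∈ d (x ∷ xs) {zero} lt = here refl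
nth-∈ d (x ∷ xs) {suc i} lt = there (nth-∈ d xs (s≤s⁻¹ lt))

nth-AllPairs : {A : Set} {R : A → A → Set} (d : A) {xs : List A} → AllPairs R xs →
  ∀ {i j} → i < j → j < length xs → R (nth d xs i) (nth d xs j)
nth-AllPairs d {x ∷ xs} (p ∷ ps) {zero} {suc j} i<j j< = All.lookup p (nth-∈ d xs (s≤s⁻¹ j<))
nth-AllPairs d {x ∷ xs} (p ∷ ps) {suc i} {suc j} i<j j< = nth-AllPairs d ps (s≤s⁻¹ i<j) (s≤s⁻¹ j<)

separated⇒injective : ∀ {m} {A : Set} (f : Fin m → A) → (∀ i j → toℕ i < toℕ j → f i ≢ f j) → Injective _≡_ _≡_ f
separated⇒injective f sep {i} {j} e with ℕₚ.<-cmp (toℕ i) (toℕ j)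
... | tri< lt _ _ = ⊥-elim (sep i j lt e)
... | tri≈ _ eq _ = Finₚ.toℕ-injective eq
... | tri> _ _ gt = ⊥-elim (sep j i gt (sym e))

distinct-length-≤ : ∀ {n} (xs : List (Fin n)) → AllPairs _≢_ xs → length xs ≤ n
distinct-length-≤ [] _ = z≤n
distinct-length-≤ (x ∷ xs) ds = Finₚ.injective⇒≤
  (separated⇒injective (λ i → nth x (x ∷ xs) (toℕ i)) λ i j i<j → nth-AllPairs x ds i<j (Finₚ.toℕ<n j))

injective⇒inverse : ∀ {m} (f : Fin m → Fin m) → Injective _≡_ _≡_ f →
  ∃ λ g → (∀ v → f (g v) ≡ v) × (∀ i → g (f i) ≡ i)
injective⇒inverse {m} f inj = (λ v → proj₁ (pre v)) , (λ v → proj₂ (pre v)) , λ i → inj (proj₂ (pre (f i)))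
  where
  pre : ∀ v → ∃ λ i → f i ≡ v
  pre v with Finₚ.any? (λ i → f i Finₚ.≟ v)
  ... | yes p = p
  ... | no ¬p = ⊥-elim (missed m f inj v (λ i e → ¬p (i , e)))
    where
    missed : ∀ m (f : Fin m → Fin m) → Injective _≡_ _≡_ f → ∀ v → (∀ i → f i ≢ v) → ⊥
    -- Punching out the missed value `v` would inject `Fin (suc m)` into `Fin m`.
    missed (suc m) f inj v ne = Finₚ.<⇒notInjective (ℕₚ.n<1+n m) punched
      where
      punched : Injective _≡_ _≡_ (λ i → punchOut {i = v} (ne i ∘ sym))
      punched e = inj (Finₚ.punchOut-injective (ne _ ∘ sym) (ne _ ∘ sym) e)

-- Standardisation

filter-length-< : {A : Set} {P Q : A → Set} (P? : Decidable P) (Q? : Decidable Q) → (∀ {x} → P x → Q x) →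
  ∀ {x} xs → x ∈ xs → Q x → ¬ P x → length (filter P? xs) < length (filter Q? xs)
filter-length-< {P = P} {Q} P? Q? P⇒Q (x ∷ xs) (here refl) qx ¬px with P? x | Q? x
... | yes p | _ = ⊥-elim (¬px p)
... | no _ | no ¬q = ⊥-elim (¬q qx)
... | no _ | yes _ = s≤s (weak xs)
  where
  weak : ∀ xs → length (filter P? xs) ≤ length (filter Q? xs)
  weak [] = z≤n
  weak (x ∷ xs) with P? x | Q? x
  ... | yes p | yes _ = s≤s (weak xs)
  ... | yes p | no ¬q = ⊥-elim (¬q (P⇒Q p))
  ... | no _ | yes _ = ℕₚ.m≤n⇒m≤1+n (weak xs)
  ... | no _ | no _ = weak xs
filter-length-< P? Q? P⇒Q (x ∷ xs) (there m) qx ¬px with P? x | Q? x | filter-length-< P? Q? P⇒Q xs m qx ¬px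
... | yes p | yes _ | ih = s≤s ih
... | yes p | no ¬q | ih = ⊥-elim (¬q (P⇒Q p))
... | no _ | yes _ | ih = ℕₚ.m≤n⇒m≤1+n ih
... | no _ | no _ | ih = ih

OrderEmbedding : ∀ {m} → (Fin m → Fin m → Set) → (Fin m → Fin m) → Set
OrderEmbedding R σ = ∀ i j → (toℕ (σ i) < toℕ (σ j) → R i j) × (R i j → toℕ (σ i) < toℕ (σ j))

-- The number of `R`-predecessors of an index is strictly monotone, and it is below `m` because no
-- index precedes itself.
standardise : ∀ {m} {R : Fin m → Fin m → Set} → (∀ i j → Dec (R i j)) → (∀ {i j l} → R i j → R j l → R i l) →
  (∀ {i} → ¬ R i i) → (∀ i j → i ≡ j ⊎ (R i j ⊎ R j i)) → ∃ λ σ → IsPerm σ × OrderEmbedding R σ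
standardise {m} {R} R? R-trans R-irrefl R-connex = σ , σ-inj , λ i j → σ-reflects i j , σ-mono i j
  where
  rank : Fin m → ℕ
  rank i = length (filter (λ j → R? j i) (allFin m))
  length-allFin : length (allFin m) ≡ m
  length-allFin = length-tabulate id
  rank<m : ∀ i → rank i < m
  rank<m i = ℕₚ.<-≤-trans (filter-notAll (λ j → R? j i) (allFin m) (lose (∈-allFin i) R-irrefl)) (ℕₚ.≤-reflexive length-allFin)
  σ : Fin m → Fin m
  σ i = fromℕ< (rank<m i)
  σ-mono : ∀ i j → R i j → toℕ (σ i) < toℕ (σ j)
  σ-mono i j r = subst₂ _<_ (sym (Finₚ.toℕ-fromℕ< (rank<m i))) (sym (Finₚ.toℕ-fromℕ< (rank<m j)))
    (filter-length-< (λ l → R? l i) (λ l → R? l j) (λ q → R-trans q r) (allFin m) (∈-allFin i) r R-irrefl)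
  σ-reflects : ∀ i j → toℕ (σ i) < toℕ (σ j) → R i j
  σ-reflects i j lt with R-connex i j
  ... | inj₁ refl = ⊥-elim (ℕₚ.<-irrefl refl lt)
  ... | inj₂ (inj₁ r) = r
  ... | inj₂ (inj₂ r) = ⊥-elim (ℕₚ.<-asym lt (σ-mono j i r))
  σ-inj : IsPerm σ
  σ-inj {i} {j} e with R-connex i j
  ... | inj₁ eq = eq
  ... | inj₂ (inj₁ r) = ⊥-elim (ℕₚ.<-irrefl (cong toℕ e) (σ-mono i j r))
  ... | inj₂ (inj₂ r) = ⊥-elim (ℕₚ.<-irrefl (cong toℕ (sym e)) (σ-mono j i r))

-- Symmetries

opposite-< : ∀ {m} {i j : Fin m} → toℕ i < toℕ j → toℕ (opposite j) < toℕ (opposite i)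
opposite-< {m} {i} {j} lt = subst₂ _<_ (sym (Finₚ.opposite-prop j)) (sym (Finₚ.opposite-prop i))
  (ℕₚ.∸-monoʳ-< (s≤s lt) (Finₚ.toℕ<n j))

opposite-<⁻¹ : ∀ {m} {i j : Fin m} → toℕ (opposite i) < toℕ (opposite j) → toℕ j < toℕ i
opposite-<⁻¹ {i = i} {j} lt = subst₂ (λ a b → toℕ a < toℕ b) (Finₚ.opposite-involutive j) (Finₚ.opposite-involutive i) (opposite-< lt)

opposite-injective : ∀ {m} {i j : Fin m} → opposite i ≡ opposite j → i ≡ j
opposite-injective {i = i} {j} e = trans (sym (Finₚ.opposite-involutive i)) (trans (cong opposite e) (Finₚ.opposite-involutive j))

2*suc : ∀ j → 2 * suc j ≡ suc (suc (2 * j))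
2*suc j = cong suc (ℕₚ.+-suc j (j + 0))

-- The form that reversal needs: in length `2 * suc (j + d)` the positions `2 * j` and `suc (2 * d)`
-- are opposite to each other, so reversal exchanges the parities.
2*-+ : ∀ j d → 2 * suc (j + d) ≡ suc (2 * j) + suc (2 * d)
2*-+ j d = trans (2*suc (j + d)) (trans (cong (suc ∘ suc) (ℕₚ.*-distribˡ-+ 2 j d)) (cong suc (sym (ℕₚ.+-suc (2 * j) (2 * d)))))

opposite-odd : ∀ {k} (i : Fin (2 * k)) → OddPos i → EvenPos (opposite i)
opposite-odd {k} i (j , e) with ℕₚ.*-cancelˡ-< 2 j k (subst (_< 2 * k) e (Finₚ.toℕ<n i))
... | j<k with ℕₚ.m≤n⇒∃[o]m+o≡n j<k
...   | d , refl = d , trans (Finₚ.opposite-prop i)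
        (trans (cong₂ _∸_ (2*-+ j d) (cong suc e)) (ℕₚ.m+n∸m≡n (suc (2 * j)) (suc (2 * d))))

opposite-even : ∀ {k} (i : Fin (2 * k)) → EvenPos i → OddPos (opposite i)
opposite-even {k} i (j , e)
  with ℕₚ.*-cancelˡ-< 2 j k (ℕₚ.<-trans (ℕₚ.n<1+n (2 * j)) (subst (_< 2 * k) e (Finₚ.toℕ<n i)))
... | j<k with ℕₚ.m≤n⇒∃[o]m+o≡n j<k
...   | d , refl = d , trans (Finₚ.opposite-prop i)
        (trans (cong₂ _∸_ (trans (2*-+ j d) (ℕₚ.+-suc (suc (2 * j)) (2 * d))) (cong suc e)) (ℕₚ.m+n∸m≡n (suc (suc (2 * j))) (2 * d)))

-- Inversion is treated apart, in `contains-or-inverse`, since it corresponds to an exchange of the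
-- axes and not to a change of sign.
record SymmetryClosed {m : ℕ} (Φ : (Fin m → Fin m) → Set) : Set where
  field
    reverse-closed : ∀ σ → Φ σ → Φ (σ ∘ opposite)
    complement-closed : ∀ σ → Φ σ → Φ (opposite ∘ σ)

parallelVertical-closed : ∀ {k} → SymmetryClosed (ParallelVerticalAlternation {2 * k})
parallelVertical-closed {k} = record { reverse-closed = rev ; complement-closed = comp }
  where
  odd = opposite-odd {k}
  even = opposite-even {k}
  rev : ∀ σ → ParallelVerticalAlternation {2 * k} σ → ParallelVerticalAlternation (σ ∘ opposite)
  rev σ (v , m) = v' v , m' m
    where
    v' : VerticalAlternation σ → VerticalAlternation (σ ∘ opposite)
    v' (inj₁ f) = inj₂ λ i j o e → f (opposite j) (opposite i) (even j e) (odd i o)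
    v' (inj₂ f) = inj₁ λ i j o e → f (opposite j) (opposite i) (even j e) (odd i o)
    m' : _ → _
    m' (inj₁ (f , g)) = inj₂
      ((λ i j p q lt → g (opposite j) (opposite i) (odd j q) (odd i p) (opposite-< lt)) ,
       (λ i j p q lt → f (opposite j) (opposite i) (even j q) (even i p) (opposite-< lt)))
    m' (inj₂ (f , g)) = inj₁
      ((λ i j p q lt → g (opposite j) (opposite i) (odd j q) (odd i p) (opposite-< lt)) ,
       (λ i j p q lt → f (opposite j) (opposite i) (even j q) (even i p) (opposite-< lt)))
  comp : ∀ σ → ParallelVerticalAlternation {2 * k} σ → ParallelVerticalAlternation (opposite ∘ σ)
  comp σ (v , m) = v' v , m' m
    where
    v' : VerticalAlternation σ → VerticalAlternation (opposite ∘ σ)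
    v' (inj₁ f) = inj₂ λ i j o e → opposite-< (f i j o e)
    v' (inj₂ f) = inj₁ λ i j o e → opposite-< (f i j o e)
    m' : _ → _
    m' (inj₁ (f , g)) = inj₂ ((λ i j p q lt → opposite-< (f i j p q lt)) , (λ i j p q lt → opposite-< (g i j p q lt)))
    m' (inj₂ (f , g)) = inj₁ ((λ i j p q lt → opposite-< (f i j p q lt)) , (λ i j p q lt → opposite-< (g i j p q lt)))

wedgeSimple-closed : ∀ {m} → SymmetryClosed (WedgeSimple {m})
wedgeSimple-closed = record
  { reverse-closed = λ σ w → reverse w (λ _ → refl)
  ; complement-closed = λ σ w → complement w (λ _ → refl) }

parallelVertical-inverse : ∀ {m} (σ τ : Fin m → Fin m) → IsInverse τ σ →
  ParallelVerticalAlternation τ → ParallelHorizontalAlternation σ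
parallelVertical-inverse σ τ inv (v , m) = h v , τ , inv , v , m
  where
  h : VerticalAlternation τ → HorizontalAlternation σ
  h (inj₁ f) = inj₁ λ i j o e → subst₂ (λ a b → toℕ a < toℕ b) (proj₁ inv i) (proj₁ inv j) (f (σ i) (σ j) o e)
  h (inj₂ f) = inj₂ λ i j o e → subst₂ (λ a b → toℕ a < toℕ b) (proj₁ inv j) (proj₁ inv i) (f (σ i) (σ j) o e)

-- Orientations of the plot

data Axis : Set where
  horizontal vertical : Axis

other : Axis → Axis
other horizontal = vertical
other vertical = horizontal

_≟ᵃ_ : DecidableEquality Axis
horizontal ≟ᵃ horizontal = yes refl
horizontal ≟ᵃ vertical = no λ ()
vertical ≟ᵃ horizontal = no λ ()
vertical ≟ᵃ vertical = yes refl

module Plot {n : ℕ} (π : Fin n → Fin n) (π-inj : IsPerm π) where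

  coord : Axis → Fin n → ℕ
  coord horizontal p = toℕ p
  coord vertical p = toℕ (π p)

  coord-injective : ∀ α {p q} → coord α p ≡ coord α q → p ≡ q
  coord-injective horizontal e = Finₚ.toℕ-injective e
  coord-injective vertical e = π-inj (Finₚ.toℕ-injective e)

  -- As a data type it determines its axis, sign and points, so that these can be left implicit
  -- throughout.
  data Lt : Axis → Bool → Fin n → Fin n → Set where
    pos : ∀ {α p q} → coord α p < coord α q → Lt α true p q
    neg : ∀ {α p q} → coord α q < coord α p → Lt α false p q

  unpos : ∀ {α p q} → Lt α true p q → coord α p < coord α q
  unpos (pos l) = l

  unneg : ∀ {α p q} → Lt α false p q → coord α q < coord α p
  unneg (neg l) = l

  lt-trans : ∀ {α s p q r} → Lt α s p q → Lt α s q r → Lt α s p r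
  lt-trans (pos a) (pos b) = pos (ℕₚ.<-trans a b)
  lt-trans (neg a) (neg b) = neg (ℕₚ.<-trans b a)

  lt-irrefl : ∀ {α s p} → ¬ Lt α s p p
  lt-irrefl (pos a) = ℕₚ.<-irrefl refl a
  lt-irrefl (neg a) = ℕₚ.<-irrefl refl a

  lt-asym : ∀ {α s p q} → Lt α s p q → ¬ Lt α s q p
  lt-asym a b = lt-irrefl (lt-trans a b)

  lt-flip : ∀ {α s p q} → Lt α s p q → Lt α (not s) q p
  lt-flip (pos a) = neg a
  lt-flip (neg a) = pos a

  lt-unflip : ∀ {α s p q} → Lt α (not s) p q → Lt α s q p
  lt-unflip {s = s} a = subst (λ s → Lt _ s _ _) (Boolₚ.not-involutive s) (lt-flip a)

  lt-compare : ∀ α s p q → p ≡ q ⊎ (Lt α s p q ⊎ Lt α s q p)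
  lt-compare α s p q with ℕₚ.<-cmp (coord α p) (coord α q)
  lt-compare α true p q | tri< a _ _ = inj₂ (inj₁ (pos a))
  lt-compare α false p q | tri< a _ _ = inj₂ (inj₂ (neg a))
  lt-compare α s p q | tri≈ _ e _ = inj₁ (coord-injective α e)
  lt-compare α true p q | tri> _ _ a = inj₂ (inj₂ (pos a))
  lt-compare α false p q | tri> _ _ a = inj₂ (inj₁ (neg a))

  lt-connex : ∀ α s p q → p ≢ q → Lt α s p q ⊎ Lt α s q p
  lt-connex α s p q ne with lt-compare α s p q
  ... | inj₁ e = ⊥-elim (ne e)
  ... | inj₂ c = c

  lt? : ∀ α s p q → Dec (Lt α s p q)
  lt? α s p q with lt-compare α s p q
  ... | inj₁ refl = no lt-irrefl
  ... | inj₂ (inj₁ a) = yes a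
  ... | inj₂ (inj₂ a) = no (lt-asym a)

  lt-≢ : ∀ {α s p q} → Lt α s p q → p ≢ q
  lt-≢ l refl = lt-irrefl l

  -- The pattern of `m` points seen in one of the eight orientations of the plot.
  Realises : Axis → Bool → Bool → ∀ {m} → (Fin m → Fin m) → Set
  Realises α s s' {m} σ = ∃ λ (q : Fin m → Fin n) →
    (∀ i j → toℕ i < toℕ j → Lt α s (q i) (q j)) × OrderEmbedding (λ i j → Lt (other α) s' (q i) (q j)) σ

  realises-standard : ∀ α s s' {m} (q : Fin m → Fin n) → (∀ i j → toℕ i < toℕ j → Lt α s (q i) (q j)) →
    ∃ λ σ → IsPerm σ × OrderEmbedding (λ i j → Lt (other α) s' (q i) (q j)) σ
  realises-standard α s s' q inc = standardise (λ i j → lt? (other α) s' (q i) (q j)) lt-trans lt-irrefl connex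
    where
    connex : ∀ i j → _
    connex i j with lt-compare (other α) s' (q i) (q j)
    ... | inj₁ e = inj₁ (separated⇒injective q (λ i j lt → lt-≢ (inc i j lt)) e)
    ... | inj₂ c = inj₂ c

  realises-reverse : ∀ {α s s' m} {σ : Fin m → Fin m} → Realises α s s' σ → Realises α (not s) s' (σ ∘ opposite)
  realises-reverse (q , inc , emb) =
    q ∘ opposite , (λ i j lt → lt-flip (inc _ _ (opposite-< lt))) , λ i j → emb (opposite i) (opposite j)

  realises-complement : ∀ {α s s' m} {σ : Fin m → Fin m} → Realises α s s' σ → Realises α s (not s') (opposite ∘ σ)
  realises-complement (q , inc , emb) = q , inc , λ i j →
    (λ lt → lt-flip (proj₁ (emb j i) (opposite-<⁻¹ lt))) , (λ l → opposite-< (proj₂ (emb j i) (lt-unflip l)))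

  module _ {m : ℕ} {Φ : (Fin m → Fin m) → Set} (closed : SymmetryClosed Φ) where
    open SymmetryClosed closed

    realises-positive : ∀ {α s s' σ} → IsPerm σ → Φ σ → Realises α s s' σ →
      ∃ λ τ → IsPerm τ × Φ τ × Realises α true true τ
    realises-positive {s = true} {true} {σ} i φ r = σ , i , φ , r
    realises-positive {s = false} {true} i φ r =
      _ , opposite-injective ∘ i , reverse-closed _ φ , realises-reverse r
    realises-positive {s = true} {false} i φ r =
      _ , i ∘ opposite-injective , complement-closed _ φ , realises-complement r
    realises-positive {s = false} {false} i φ r =
      _ , opposite-injective ∘ i ∘ opposite-injective , complement-closed _ (reverse-closed _ φ) ,
      realises-complement (realises-reverse r)

    -- Points listed by value realise the inverse of the pattern that they form by position; hence
    -- the second alternative, for the vertical axis.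
    contains-or-inverse : ∀ {α s s' σ} → IsPerm σ → Φ σ → Realises α s s' σ →
      ∃ λ τ → IsPerm τ × Contains π τ × (Φ τ ⊎ ∃ λ ρ → IsInverse ρ τ × Φ ρ)
    contains-or-inverse {horizontal} i φ r with realises-positive i φ r
    ... | τ , j , ψ , q , inc , emb =
      τ , j , (q , (λ a b lt → unpos (inc a b lt)) ,
               λ a b → (λ lt → unpos (proj₁ (emb a b) lt)) , (λ lt → proj₂ (emb a b) (pos lt))) , inj₁ ψ
    contains-or-inverse {vertical} i φ r with realises-positive i φ r
    ... | ρ , j , ψ , q , inc , emb with injective⇒inverse ρ j
    ...   | τ , ρτ , τρ =
      τ , (λ {a} {b} e → trans (sym (ρτ a)) (trans (cong ρ e) (ρτ b))) ,
      (q ∘ τ ,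
       (λ a b lt → unpos (proj₁ (emb (τ a) (τ b)) (subst₂ (λ u v → toℕ u < toℕ v) (sym (ρτ a)) (sym (ρτ b)) lt))) ,
       λ a b → (λ lt → unpos (inc (τ a) (τ b) lt)) , λ lt → reflect a b lt) ,
      inj₂ (ρ , (ρτ , τρ) , ψ)
      where
      reflect : ∀ a b → toℕ (π (q (τ a))) < toℕ (π (q (τ b))) → toℕ (τ a) < toℕ (τ b)
      reflect a b lt with ℕₚ.<-cmp (toℕ (τ a)) (toℕ (τ b))
      ... | tri< l _ _ = l
      ... | tri≈ _ e _ = ⊥-elim (ℕₚ.<-irrefl (cong (toℕ ∘ π ∘ q) (Finₚ.toℕ-injective e)) lt)
      ... | tri> _ _ l = ⊥-elim (ℕₚ.<-asym lt (unpos (inc (τ b) (τ a) l)))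

  ContainsUnavoidable : ℕ → Set
  ContainsUnavoidable m =
    (∃ λ (σ : Fin m → Fin m) → IsPerm σ × ParallelAlternation σ × Contains π σ)
    ⊎ (∃ λ (σ : Fin m → Fin m) → IsPerm σ × WedgeSimple σ × Contains π σ)

  parallel-contained : ∀ {k α s s' σ} → IsPerm σ → ParallelVerticalAlternation {2 * k} σ → Realises α s s' σ →
    ContainsUnavoidable (2 * k)
  parallel-contained {k} i v r with contains-or-inverse (parallelVertical-closed {k}) i v r
  ... | τ , j , c , inj₁ w = inj₁ (τ , j , inj₁ w , c)
  ... | τ , j , c , inj₂ (ρ , inv , w) = inj₁ (τ , j , inj₂ (parallelVertical-inverse τ ρ inv w) , c)

  wedge-contained : ∀ {m α s s' σ} → IsPerm σ → WedgeSimple {m} σ → Realises α s s' σ → ContainsUnavoidable m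
  wedge-contained i v r with contains-or-inverse wedgeSimple-closed i v r
  ... | τ , j , c , inj₁ w = inj₂ (τ , j , w , c)
  ... | τ , j , c , inj₂ (ρ , (a , b) , w) = inj₂ (τ , j , inverse w (b , a) , c)

-- Zigzags

alternate : {A : Set} → (ℕ → A) → (ℕ → A) → ℕ → A
alternate a c zero = a 0
alternate a c (suc i) = alternate c (a ∘ suc) i

alternate-even : {A : Set} (a c : ℕ → A) (j : ℕ) → alternate a c (2 * j) ≡ a j
alternate-even a c zero = refl
alternate-even a c (suc j) = trans (cong (alternate a c) (2*suc j)) (alternate-even (a ∘ suc) (c ∘ suc) j)

alternate-odd : {A : Set} (a c : ℕ → A) (j : ℕ) → alternate a c (suc (2 * j)) ≡ c j
alternate-odd a c j = alternate-even c (a ∘ suc) j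

parity : ∀ i → EvenN i ⊎ OddN i
parity zero = inj₁ (0 , refl)
parity (suc i) with parity i
... | inj₁ (j , e) = inj₂ (j , cong suc e)
... | inj₂ (j , e) = inj₁ (suc j , trans (cong suc e) (sym (2*suc j)))

-- Type 2 prescribes the exact value of its second entry, while standardisation yields only
-- comparisons. The largest value is attained, and no other entry can attain it.
perm-max : ∀ {m} (σ : Fin m → Fin m) → IsPerm σ → ∀ i → (∀ j → j ≢ i → toℕ (σ j) < toℕ (σ i)) → toℕ (σ i) ≡ m ∸ 1
perm-max {suc m} σ inj i max with injective⇒inverse σ inj
... | g , σg , _ with g (fromℕ m) Finₚ.≟ i
...   | yes e = trans (cong (toℕ ∘ σ) (sym e)) (trans (cong toℕ (σg _)) (Finₚ.toℕ-fromℕ m))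
...   | no ne = ⊥-elim (ℕₚ.<⇒≱ (subst (_< toℕ (σ i)) (trans (cong toℕ (σg _)) (Finₚ.toℕ-fromℕ m)) (max _ ne))
                              (s≤s⁻¹ (Finₚ.toℕ<n (σ i))))

half-< : ∀ {i j a b} → a ≡ 2 * i → b ≡ 2 * j → a < b → i < j
half-< {i} {j} refl refl lt = ℕₚ.*-cancelˡ-< 2 i j lt

half-<′ : ∀ {i j a b} → a ≡ suc (2 * i) → b ≡ suc (2 * j) → a < b → i < j
half-<′ refl refl lt = half-< refl refl (s≤s⁻¹ lt)

half-bound : ∀ {j k a} → a ≡ suc (2 * j) → a < 2 * k → j < k
half-bound refl lt = half-< refl refl (ℕₚ.<-trans (ℕₚ.n<1+n _) lt)

module Zigzags {n : ℕ} (π : Fin n → Fin n) (π-inj : IsPerm π) where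
  open Plot π π-inj

  -- The order a 0, c 0, a 1, c 1, ... along `α`. The other axis is left open: assumptions about it
  -- single out the parallel and the wedge patterns.
  record Zigzag (α : Axis) (s : Bool) (k : ℕ) (a c : ℕ → Fin n) : Set where
    field
      rise : ∀ i → i < k → Lt α s (a i) (c i)
      link : ∀ i → suc i < k → Lt α s (c i) (a (suc i))

  increasing-chain : ∀ {α s m} (f : ℕ → Fin n) → (∀ i → suc i < m → Lt α s (f i) (f (suc i))) →
    ∀ {i j} → i < j → j < m → Lt α s (f i) (f j)
  increasing-chain f step {i} {suc j} i<j j<m with ℕₚ.m≤n⇒m<n∨m≡n (s≤s⁻¹ i<j)
  ... | inj₁ i<j' = lt-trans (increasing-chain f step i<j' (ℕₚ.<-trans (ℕₚ.n<1+n j) j<m)) (step j j<m)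
  ... | inj₂ refl = step j j<m

  module _ {α : Axis} {s : Bool} (s' : Bool) {k : ℕ} {a c : ℕ → Fin n} (zz : Zigzag α s k a c) where
    open Zigzag zz

    private
      q : Fin (2 * k) → Fin n
      q i = alternate a c (toℕ i)

      step : ∀ i → suc i < 2 * k → Lt α s (alternate a c i) (alternate a c (suc i))
      step i lt with parity i
      ... | inj₁ (j , refl) = subst₂ (Lt α s) (sym (alternate-even a c j)) (sym (alternate-odd a c j))
                                (rise j (half-bound refl lt))
      ... | inj₂ (j , refl) = subst₂ (Lt α s) (sym (alternate-odd a c j))
                                (sym (trans (cong (alternate a c) (sym (2*suc j))) (alternate-even a c (suc j))))
                                (link j (half-< (sym (2*suc j)) refl lt))

      q-inc : ∀ i j → toℕ i < toℕ j → Lt α s (q i) (q j)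
      q-inc i j lt = increasing-chain (alternate a c) step lt (Finₚ.toℕ<n j)

    -- The pattern is kept abstract, so that the arguments rest on its embedding property alone.
    module Standardised (σ : Fin (2 * k) → Fin (2 * k)) (σ-perm : IsPerm σ)
                        (σ-embedding : OrderEmbedding (λ i j → Lt (other α) s' (q i) (q j)) σ) where

      private
        realised : Realises α s s' σ
        realised = q , q-inc , σ-embedding

        σ-< : ∀ {i i' p p'} → q i ≡ p → q i' ≡ p' → Lt (other α) s' p p' → toℕ (σ i) < toℕ (σ i')
        σ-< {i} {i'} refl refl l = proj₂ (σ-embedding i i') l

        odd : ∀ {i : Fin (2 * k)} ((j , _) : OddPos i) → q i ≡ a j
        odd (j , e) = trans (cong (alternate a c) e) (alternate-even a c j)

        even : ∀ {i : Fin (2 * k)} ((j , _) : EvenPos i) → q i ≡ c j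
        even (j , e) = trans (cong (alternate a c) e) (alternate-odd a c j)

        odd-< : ∀ {i : Fin (2 * k)} ((j , _) : OddPos i) → j < k
        odd-< {i} (j , e) = half-< e refl (Finₚ.toℕ<n i)

        even-< : ∀ {i : Fin (2 * k)} ((j , _) : EvenPos i) → j < k
        even-< {i} (j , e) = half-bound e (Finₚ.toℕ<n i)

      parallel : (∀ i j → i < k → j < k → Lt (other α) s' (c j) (a i)) →
        ((∀ i j → i < j → j < k → Lt (other α) s' (a i) (a j)) × (∀ i j → i < j → j < k → Lt (other α) s' (c i) (c j))) ⊎
        ((∀ i j → i < j → j < k → Lt (other α) s' (a j) (a i)) × (∀ i j → i < j → j < k → Lt (other α) s' (c j) (c i))) →
        ContainsUnavoidable (2 * k)
      parallel sep mono = parallel-contained {k = k} σ-perm (inj₂ vert , dir mono) realised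
        where
        vert : ∀ i j → OddPos i → EvenPos j → toℕ (σ j) < toℕ (σ i)
        vert i j o e = σ-< (even e) (odd o) (sep _ _ (odd-< o) (even-< e))
        dir : _ ⊎ _ → _
        dir (inj₁ (f , g)) = inj₁
          ((λ i j o o' lt → σ-< (odd o) (odd o') (f _ _ (half-< (proj₂ o) (proj₂ o') lt) (odd-< o'))) ,
           (λ i j o o' lt → σ-< (even o) (even o') (g _ _ (half-<′ (proj₂ o) (proj₂ o') lt) (even-< o'))))
        dir (inj₂ (f , g)) = inj₂
          ((λ i j o o' lt → σ-< (odd o') (odd o) (f _ _ (half-< (proj₂ o) (proj₂ o') lt) (odd-< o'))) ,
           (λ i j o o' lt → σ-< (even o') (even o) (g _ _ (half-<′ (proj₂ o) (proj₂ o') lt) (even-< o'))))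

      -- The last point `c K` of the zigzag is the closing entry of type 1 and does not belong to
      -- the decreasing arm; hence the bound `K` in the last two hypotheses.
      basic-type1 : ∀ K → k ≡ suc K → 1 ≤ K →
        (∀ i j → i < k → j < k → Lt (other α) s' (c j) (a i)) →
        (∀ i j → i < j → j < k → Lt (other α) s' (a i) (a j)) →
        (∀ i j → i < j → j < K → Lt (other α) s' (c j) (c i)) →
        (∀ i → i < K → Lt (other α) s' (c i) (c K)) →
        ContainsUnavoidable (2 * k)
      basic-type1 K refl 1≤K sep up down apex = wedge-contained σ-perm (basic1 basic) realised
        where
        ℓ-1 : 2 * suc K ∸ 1 ≡ suc (2 * K)
        ℓ-1 = cong (_∸ 1) (2*suc K)
        inner : ∀ {i : Fin (2 * suc K)} ((j , _) : EvenPos i) → toℕ i < 2 * suc K ∸ 1 → j < K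
        inner {i} (j , e) lt = half-<′ e refl (subst (toℕ i <_) ℓ-1 lt)
        last-even : ∀ {l : Fin (2 * suc K)} → toℕ l ≡ 2 * suc K ∸ 1 → EvenPos l
        last-even e = K , trans e ℓ-1
        basic : BasicType1 σ
        basic = σ-perm , ℕₚ.*-monoʳ-≤ 2 (s≤s 1≤K) ,
          (λ i j _ _ o o' lt → σ-< (odd o) (odd o') (up _ _ (half-< (proj₂ o) (proj₂ o') lt) (odd-< o'))) ,
          (λ i j _ j< o o' lt → σ-< (even o') (even o) (down _ _ (half-<′ (proj₂ o) (proj₂ o') lt) (inner {j} o' j<))) ,
          (λ i j _ _ o e → σ-< (even e) (odd o) (sep _ _ (odd-< o) (even-< e))) ,
          λ l i l≡ i< →
            (λ o → σ-< (even {l} (last-even {l} l≡)) (odd o) (sep _ _ (odd-< o) (ℕₚ.n<1+n K))) ,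
            (λ e → σ-< (even e) (even {l} (last-even {l} l≡)) (apex _ (inner {i} e i<)))

      -- The zigzag starts with the middle entry a 0 and the maximum c 0.
      basic-type2 : 2 ≤ k →
        (∀ i → i < k → Lt (other α) s' (a i) (c 0)) →
        (∀ i → 0 < i → i < k → Lt (other α) s' (c i) (c 0)) →
        (∀ i → 0 < i → i < k → Lt (other α) s' (a i) (a 0)) →
        (∀ i → 0 < i → i < k → Lt (other α) s' (a 0) (c i)) →
        (∀ i j → 0 < i → i < j → j < k → Lt (other α) s' (a j) (a i)) →
        (∀ i j → 0 < i → i < j → j < k → Lt (other α) s' (c i) (c j)) →
        ContainsUnavoidable (2 * k)
      basic-type2 2≤k a<top c<top low high down up = wedge-contained σ-perm (basic2 basic) realised
        where
        odd-pos : ∀ {t j} → t ≡ 2 * j → 2 ≤ t → 0 < j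
        odd-pos {j = zero} refl ()
        odd-pos {j = suc j} _ _ = s≤s z≤n
        even-pos : ∀ {t j} → t ≡ suc (2 * j) → 3 ≤ t → 0 < j
        even-pos {j = zero} refl (s≤s ())
        even-pos {j = suc j} _ _ = s≤s z≤n
        below-top : ∀ (i : Fin (2 * k)) → toℕ i ≡ 1 → ∀ j → j ≢ i → toℕ (σ j) < toℕ (σ i)
        below-top i e j ne with parity (toℕ j)
        ... | inj₁ o = σ-< (odd o) (even {i} (0 , e)) (a<top _ (odd-< {j} o))
        ... | inj₂ (zero , e') = ⊥-elim (ne (Finₚ.toℕ-injective (trans e' (sym e))))
        ... | inj₂ (suc l , e') = σ-< (even {j} (suc l , e')) (even {i} (0 , e)) (c<top _ (s≤s z≤n) (even-< {j} (suc l , e')))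
        basic : BasicType2 σ
        basic = σ-perm , ℕₚ.*-monoʳ-≤ 2 2≤k , (k , refl) ,
          (λ i e → perm-max σ σ-perm i (below-top i e)) ,
          (λ i j 2≤i _ o o' lt →
            σ-< (odd o') (odd o) (down _ _ (odd-pos (proj₂ o) 2≤i) (half-< (proj₂ o) (proj₂ o') lt) (odd-< o'))) ,
          (λ i j 3≤i _ o o' lt →
            σ-< (even o) (even o') (up _ _ (even-pos (proj₂ o) 3≤i) (half-<′ (proj₂ o) (proj₂ o') lt) (even-< o'))) ,
          λ f i f≡0 →
            (λ 2≤i o → σ-< (odd o) (odd {f} (0 , f≡0)) (low _ (odd-pos (proj₂ o) 2≤i) (odd-< o))) ,
            (λ 3≤i e → σ-< (odd {f} (0 , f≡0)) (even e) (high _ (even-pos (proj₂ e) 3≤i) (even-< e)))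

    private
      std = realises-standard α s s' q q-inc

    open Standardised (proj₁ std) (proj₁ (proj₂ std)) (proj₂ (proj₂ std)) public

-- Pin sequences, listed with the most recent pin first

module PinSequences {n : ℕ} (π : Fin n → Fin n) (π-inj : IsPerm π) where
  open Plot π π-inj

  Within : Axis → List (Fin n) → Fin n → Set
  Within α S w = Any (λ p → Lt α true p w) S × Any (λ p → Lt α true w p) S

  within? : ∀ α S w → Dec (Within α S w)
  within? α S w = Any.any? (λ p → lt? α true p w) S ×-dec Any.any? (λ p → lt? α true w p) S

  within-mono : ∀ {α S S' w} → (∀ {p} → p ∈ S → p ∈ S') → Within α S w → Within α S' w
  within-mono {S' = S'} inc (lo , hi) = weaken lo , weaken hi
    where
    weaken : ∀ {Q : Fin n → Set} → Any Q _ → Any Q S'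
    weaken a = let (_ , m , q) = find a in lose (inc m) q

  -- A pin that satisfies maximality but perhaps not separation.
  record Pin (α : Axis) (s : Bool) (q : Fin n) (S : List (Fin n)) : Set where
    field
      beyond : All (λ p → Lt α s p q) S
      within : Within (other α) S q
      extreme : ∀ w → Lt α s q w → ¬ Within (other α) S w

  -- Here `s'` is the direction from `R` to `p` on the axis along which `q` separates them. For
  -- nonempty `R` this already puts `q` into the band.
  record SeparatingPin (α : Axis) (s s' : Bool) (q p : Fin n) (R : List (Fin n)) : Set where
    field
      beyond : All (λ r → Lt α s r q) (p ∷ R)
      before : Lt (other α) s' q p
      after : All (λ r → Lt (other α) s' r q) R
      extreme : ∀ w → Lt α s q w → ¬ Within (other α) (p ∷ R) w

  data Growing (p₁ p₂ : Fin n) : List (Fin n) → Set where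
    start : Growing p₁ p₂ (p₂ ∷ p₁ ∷ [])
    grow : ∀ {α s q S} → Pin α s q S → Growing p₁ p₂ S → Growing p₁ p₂ (q ∷ S)

  data Proper (p₁ p₂ : Fin n) : List (Fin n) → Set where
    start : Proper p₁ p₂ (p₂ ∷ p₁ ∷ [])
    extend : ∀ {α s s' q p R} → SeparatingPin α s s' q p R → Proper p₁ p₂ (p ∷ R) → Proper p₁ p₂ (q ∷ p ∷ R)

  proper-nonempty : ∀ {p₁ p₂ q T} → Proper p₁ p₂ (q ∷ T) → 0 < length T
  proper-nonempty start = s≤s z≤n
  proper-nonempty (extend _ _) = s≤s z≤n

  -- Dropping points narrows the band, so `q` has fewer competitors; only its own place in the band
  -- has to be checked again.
  pin-mono : ∀ {α s q S S'} → (∀ {p} → p ∈ S' → p ∈ S) → Within (other α) S' q → Pin α s q S → Pin α s q S'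
  pin-mono inc w pin = record
    { beyond = All.tabulate (All.lookup (Pin.beyond pin) ∘ inc)
    ; within = w
    ; extreme = λ u l → Pin.extreme pin u l ∘ within-mono inc }

  -- If `q` is enclosed only thanks to `p`, then `p` is alone on its side of `q`.
  separates : ∀ {β q p R} → All (_≢ q) R → Within β (p ∷ R) q → ¬ Within β R q →
    ∃ λ s' → Lt β s' q p × All (λ r → Lt β s' r q) R
  separates ne (here l , here l') nw = ⊥-elim (lt-asym l l')
  separates ne (there a , there b) nw = ⊥-elim (nw (a , b))
  separates {β} {q} {p} {R} ne (here l , there b) nw = false , lt-flip l , All.map side (All.zip (ne , All.tabulate id))
    where
    side : ∀ {r} → r ≢ q × r ∈ R → Lt β false r q
    side {r} (r≢q , r∈) with lt-connex β true r q r≢q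
    ... | inj₁ r<q = ⊥-elim (nw (lose r∈ r<q , b))
    ... | inj₂ q<r = lt-flip q<r
  separates {β} {q} {p} {R} ne (there a , here l) nw = true , l , All.map side (All.zip (ne , All.tabulate id))
    where
    side : ∀ {r} → r ≢ q × r ∈ R → Lt β true r q
    side {r} (r≢q , r∈) with lt-connex β true r q r≢q
    ... | inj₁ r<q = r<q
    ... | inj₂ q<r = ⊥-elim (nw (a , lose r∈ q<r))

  separating-pin : ∀ {α s q p R R'} → Pin α s q (p ∷ R) → ¬ Within (other α) R q → (∀ {r} → r ∈ R' → r ∈ R) →
    ∃ λ s' → SeparatingPin α s s' q p R'
  separating-pin {R' = R'} pin nw inc with Pin.beyond pin
  ... | b ∷ bs with separates (All.map lt-≢ bs) (Pin.within pin) nw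
  ...   | s' , bf , af = s' , record
    { beyond = b ∷ All.tabulate (All.lookup bs ∘ inc)
    ; before = bf
    ; after = All.tabulate (All.lookup af ∘ inc)
    ; extreme = λ w l → Pin.extreme pin w l ∘ within-mono inc' }
    where
    inc' : ∀ {r} → r ∈ _ ∷ R' → r ∈ _ ∷ _
    inc' (here e) = here e
    inc' (there m) = there (inc m)

  -- Keep only the shortest initial part of the sequence for which q is still a pin; its last point is then
  -- separated by q from the points before it.
  proper-ending-in : ∀ {p₁ p₂ S α s q} → Growing p₁ p₂ S → Pin α s q S →
    ∃ λ T → Proper p₁ p₂ (q ∷ T) × (∀ {t} → t ∈ T → t ∈ S)
  proper-ending-in {α = α} {q = q} start pin with separating-pin pin single id
    where
    single : ¬ Within (other α) (_ ∷ []) q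
    single (here l , here l') = lt-asym l l'
  ... | s' , sep = _ , extend sep start , id
  proper-ending-in {α = α} {q = q} (grow {q = p} {S = R} pin' g) pin with within? (other α) R q
  ... | yes w with proper-ending-in g (pin-mono there w pin)
  ...   | T , pr , inc = T , pr , there ∘ inc
  proper-ending-in {α = α} {q = q} (grow {q = p} {S = R} pin' g) pin | no nw with proper-ending-in g pin'
  ... | T , pr , inc with separating-pin pin nw inc
  ...   | s' , sep = p ∷ T , extend sep pr , inc'
    where
    inc' : ∀ {t} → t ∈ p ∷ T → t ∈ p ∷ R
    inc' (here e) = here e
    inc' (there m) = there (inc m)

  proper-to-member : ∀ {p₁ p₂ S q} → Growing p₁ p₂ S → q ∈ S → (q ≡ p₁ ⊎ q ≡ p₂) ⊎ ∃ λ T → Proper p₁ p₂ (q ∷ T)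
  proper-to-member start (here e) = inj₁ (inj₂ e)
  proper-to-member start (there (here e)) = inj₁ (inj₁ e)
  proper-to-member (grow pin g) (here refl) with proper-ending-in g pin
  ... | T , pr , _ = inj₂ (T , pr)
  proper-to-member (grow pin g) (there m) = proper-to-member g m

  -- Simplicity

  -- Only the horizontal extent is recorded, since the sequences are used to reach the leftmost or
  -- the rightmost point.
  Spanning : List (Fin n) → Set
  Spanning S = Any (λ p → toℕ p ≡ 0) S × Any (λ p → suc (toℕ p) ≡ n) S

  -- The farthest point of the whole band is taken. It lies beyond `S` because it is at least as far
  -- out as the given candidate.
  maximal-pin : ∀ α s S → (∃ λ q → All (λ p → Lt α s p q) S × Within (other α) S q) → ∃ λ q → Pin α s q S
  maximal-pin α s S (q , b , w) with filter (within? (other α) S) (allFin n) in eq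
  ... | [] with subst (q ∈_) eq (∈-filter⁺ (within? (other α) S) (∈-allFin q) w)
  ...   | ()
  maximal-pin α s S (q , b , w) | x ∷ xs with greatest {_≺_ = Lt α s} lt-trans (lt-compare α s) x xs
  ... | m , m∈ , max = m , record
    { beyond = All.map past b
    ; within = proj₂ (∈-filter⁻ (within? (other α) S) {xs = allFin n} (subst (m ∈_) (sym eq) m∈))
    ; extreme = λ u l w' → not-past u l (All.lookup max (candidate w')) }
    where
    candidate : ∀ {u} → Within (other α) S u → u ∈ x ∷ xs
    candidate {u} w' = subst (u ∈_) eq (∈-filter⁺ (within? (other α) S) (∈-allFin u) w')
    past : ∀ {p} → Lt α s p q → Lt α s p m
    past l with All.lookup max (candidate w)
    ... | inj₁ refl = l
    ... | inj₂ l' = lt-trans l l'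
    not-past : ∀ u → Lt α s m u → ¬ (u ≡ m ⊎ Lt α s u m)
    not-past u l (inj₁ refl) = lt-irrefl l
    not-past u l (inj₂ l') = lt-asym l l'

  module _ (simple : Simple π) (x y : Fin n) (R : List (Fin n)) (x≢y : x ≢ y)
           (no-pin : ∀ α s → ¬ ∃ λ q → All (λ p → Lt α s p q) (x ∷ y ∷ R) × Within (other α) (x ∷ y ∷ R) q) where

    private
      S : List (Fin n)
      S = x ∷ y ∷ R

      hi : ∀ α → ∃ λ m → m ∈ S × All (λ p → p ≡ m ⊎ Lt α true p m) S
      hi α = greatest lt-trans (lt-compare α true) x (y ∷ R)

      lo : ∀ α → ∃ λ m → m ∈ S × All (λ p → p ≡ m ⊎ Lt α false p m) S
      lo α = greatest lt-trans (lt-compare α false) x (y ∷ R)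

      H L : Axis → ℕ
      H α = coord α (proj₁ (hi α))
      L α = coord α (proj₁ (lo α))

      ≤H : ∀ α {p} → p ∈ S → coord α p ≤ H α
      ≤H α m with All.lookup (proj₂ (proj₂ (hi α))) m
      ... | inj₁ refl = ℕₚ.≤-refl
      ... | inj₂ l = ℕₚ.<⇒≤ (unpos l)

      L≤ : ∀ α {p} → p ∈ S → L α ≤ coord α p
      L≤ α m with All.lookup (proj₂ (proj₂ (lo α))) m
      ... | inj₁ refl = ℕₚ.≤-refl
      ... | inj₂ l = ℕₚ.<⇒≤ (unneg l)

      Box : Axis → Fin n → Set
      Box α t = L α ≤ coord α t × coord α t ≤ H α

      within-box : ∀ α t → ¬ (t ∈ S) → Box α t → Within α S t
      within-box α t t∉ (l , h) =
        lose (proj₁ (proj₂ (lo α))) (pos (ℕₚ.≤∧≢⇒< l λ e → t∉ (subst (_∈ S) (coord-injective α e) (proj₁ (proj₂ (lo α)))))) ,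
        lose (proj₁ (proj₂ (hi α))) (pos (ℕₚ.≤∧≢⇒< h λ e → t∉ (subst (_∈ S) (coord-injective α (sym e)) (proj₁ (proj₂ (hi α))))))

      -- A point that is in the bounding box along one axis and outside it along the other would be
      -- a pin.
      transfer : ∀ α t → Box (other α) t → Box α t
      transfer α t box = ℕₚ.≮⇒≥ low , ℕₚ.≮⇒≥ high
        where
        low : ¬ (coord α t < L α)
        low lt = no-pin α false (t , All.tabulate (λ m → neg (ℕₚ.<-≤-trans lt (L≤ α m))) ,
          within-box (other α) t (λ m → ℕₚ.<⇒≱ lt (L≤ α m)) box)
        high : ¬ (H α < coord α t)
        high lt = no-pin α true (t , All.tabulate (λ m → pos (ℕₚ.≤-<-trans (≤H α m) lt)) ,
          within-box (other α) t (λ m → ℕₚ.<⇒≱ lt (≤H α m)) box)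

      L<H : L horizontal < H horizontal
      L<H with ℕₚ.<-cmp (toℕ x) (toℕ y)
      ... | tri< l _ _ = ℕₚ.≤-<-trans (L≤ horizontal (here refl)) (ℕₚ.<-≤-trans l (≤H horizontal (there (here refl))))
      ... | tri≈ _ e _ = ⊥-elim (x≢y (Finₚ.toℕ-injective e))
      ... | tri> _ _ l = ℕₚ.≤-<-trans (L≤ horizontal (there (here refl))) (ℕₚ.<-≤-trans l (≤H horizontal (here refl)))

      -- A value between two values of the box is in its vertical range, so by `transfer` its
      -- position is in the horizontal range.
      interval : IsInterval π (proj₁ (lo horizontal)) (proj₁ (hi horizontal))
      interval t u a≤t t≤b a≤u u≤b v t≤v v≤u with injective⇒inverse π π-inj
      ... | g , πg , _ = g v , proj₁ box , proj₂ box , πg v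
        where
        box : Box horizontal (g v)
        box = transfer horizontal (g v)
          (subst (λ w → L vertical ≤ toℕ w × toℕ w ≤ H vertical) (sym (πg v))
            (ℕₚ.≤-trans (proj₁ (transfer vertical t (a≤t , t≤b))) t≤v ,
             ℕₚ.≤-trans v≤u (proj₂ (transfer vertical u (a≤u , u≤b)))))

      whole : ∀ {a b} → a < b → b < n → (suc b ∸ a ≡ 1) ⊎ (suc b ∸ a ≡ n) → a ≡ 0 × suc b ≡ n
      whole {a} {b} a<b b<n (inj₁ e) =
        ⊥-elim (ℕₚ.<-irrefl (sym (trans (sym (ℕₚ.+-∸-assoc 1 (ℕₚ.<⇒≤ a<b))) e)) (s≤s (ℕₚ.m<n⇒0<n∸m a<b)))
      whole {a} {b} a<b b<n (inj₂ e) = a≡0 , trans (cong (suc b ∸_) (sym a≡0)) e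
        where
        a≡0 : a ≡ 0
        a≡0 = ℕₚ.n≤0⇒n≡0 (ℕₚ.+-cancelʳ-≤ n a 0 (ℕₚ.≤-trans
          (ℕₚ.≤-reflexive (trans (cong (a +_) (sym e)) (ℕₚ.m+[n∸m]≡n (ℕₚ.m≤n⇒m≤1+n (ℕₚ.<⇒≤ a<b))))) b<n))

    unpinned⇒spanning : Spanning S
    unpinned⇒spanning with whole L<H (Finₚ.toℕ<n _) (simple _ _ (ℕₚ.<⇒≤ L<H) interval)
    ... | e , e' = lose (proj₁ (proj₂ (lo horizontal))) e , lose (proj₁ (proj₂ (hi horizontal))) e'

  growing-distinct : ∀ {p₁ p₂ S} → p₁ ≢ p₂ → Growing p₁ p₂ S → AllPairs _≢_ S
  growing-distinct ne start = ((ne ∘ sym) ∷ []) ∷ [] ∷ []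
  growing-distinct ne (grow pin g) = All.map (λ l e → lt-≢ l (sym e)) (Pin.beyond pin) ∷ growing-distinct ne g

  pin? : ∀ α s S → Dec (∃ λ q → All (λ p → Lt α s p q) S × Within (other α) S q)
  pin? α s S = Finₚ.any? (λ q → All.all? (λ p → lt? α s p q) S ×-dec within? (other α) S q)

  pin-or-spanning : Simple π → ∀ {p₁ p₂ S} → p₁ ≢ p₂ → Growing p₁ p₂ S →
    (∃ λ α → ∃₂ λ s q → Pin α s q S) ⊎ Spanning S
  pin-or-spanning simple {S = S} ne g
    with pin? horizontal true S | pin? horizontal false S | pin? vertical true S | pin? vertical false S
  ... | yes q | _ | _ | _ = inj₁ (_ , _ , maximal-pin _ _ S q)
  ... | _ | yes q | _ | _ = inj₁ (_ , _ , maximal-pin _ _ S q)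
  ... | _ | _ | yes q | _ = inj₁ (_ , _ , maximal-pin _ _ S q)
  ... | _ | _ | _ | yes q = inj₁ (_ , _ , maximal-pin _ _ S q)
  ... | no a | no b | no c | no d = inj₂ (spanning g)
    where
    none : ∀ α s → ¬ ∃ λ q → All (λ p → Lt α s p q) S × Within (other α) S q
    none horizontal true = a
    none horizontal false = b
    none vertical true = c
    none vertical false = d
    spanning : Growing _ _ S → Spanning S
    -- The case split exposes the two newest points; that they differ rules out an interval of size
    -- 1.
    spanning start = unpinned⇒spanning simple _ _ _ (ne ∘ sym) none
    spanning g@(grow _ start) = unpinned⇒spanning simple _ _ _ (All.head (AllPairs.head (growing-distinct ne g))) none
    spanning g@(grow _ (grow _ _)) = unpinned⇒spanning simple _ _ _ (All.head (AllPairs.head (growing-distinct ne g))) none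

  -- The fuel `f` bounds the number of points not yet used: once it is spent, a further pin would
  -- give more than `n` distinct points.
  grow-until-spanning : Simple π → ∀ {p₁ p₂} → p₁ ≢ p₂ → ∀ f {S} → Growing p₁ p₂ S → n ≤ f + length S →
    ∃ λ S' → Growing p₁ p₂ S' × Spanning S'
  grow-until-spanning simple ne f {S} g le with pin-or-spanning simple ne g
  ... | inj₂ sp = S , g , sp
  grow-until-spanning simple ne zero g le | inj₁ (_ , _ , _ , pin) =
    ⊥-elim (ℕₚ.<⇒≱ (distinct-length-≤ _ (growing-distinct ne (grow pin g))) le)
  grow-until-spanning simple ne (suc f) g le | inj₁ (_ , _ , _ , pin) =
    grow-until-spanning simple ne f (grow pin g) (ℕₚ.≤-trans le (ℕₚ.≤-reflexive (sym (ℕₚ.+-suc f _))))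

  reach : Simple π → ∀ {p₁ p₂ r} → p₁ ≢ p₂ → toℕ r ≡ 0 ⊎ suc (toℕ r) ≡ n → r ≢ p₁ → r ≢ p₂ →
    ∃ λ T → Proper p₁ p₂ (r ∷ T)
  reach simple {p₁} {p₂} {r} ne end r≢p₁ r≢p₂ with grow-until-spanning simple ne n start (ℕₚ.m≤m+n n 2)
  ... | S , g , sp with proper-to-member g (member end)
    where
    member : toℕ r ≡ 0 ⊎ suc (toℕ r) ≡ n → r ∈ S
    member (inj₁ e) = Any.map (λ e' → Finₚ.toℕ-injective (trans e (sym e'))) (proj₁ sp)
    member (inj₂ e) = Any.map (λ e' → Finₚ.toℕ-injective (ℕₚ.suc-injective (trans e (sym e')))) (proj₂ sp)
  ...   | inj₁ (inj₁ e) = ⊥-elim (r≢p₁ e)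
  ...   | inj₁ (inj₂ e) = ⊥-elim (r≢p₂ e)
  ...   | inj₂ pr = pr

-- Pin lists as indexed sequences, counted from the oldest point

fromEnd : {A : Set} → A → List A → ℕ → A
fromEnd d [] i = d
fromEnd d (x ∷ xs) i with i ℕₚ.≟ length xs
... | yes _ = x
... | no _ = fromEnd d xs i

fromEnd-head : {A : Set} (d x : A) (xs : List A) {i : ℕ} → i ≡ length xs → fromEnd d (x ∷ xs) i ≡ x
fromEnd-head d x xs {i} e with i ℕₚ.≟ length xs
... | yes _ = refl
... | no ne = ⊥-elim (ne e)

fromEnd-tail : {A : Set} (d x : A) (xs : List A) {i : ℕ} → i < length xs → fromEnd d (x ∷ xs) i ≡ fromEnd d xs i
fromEnd-tail d x xs {i} lt with i ℕₚ.≟ length xs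
... | yes e = ⊥-elim (ℕₚ.<-irrefl e lt)
... | no _ = refl

fromEnd-∈ : {A : Set} (d : A) (xs : List A) {i : ℕ} → i < length xs → fromEnd d xs i ∈ xs
fromEnd-∈ d (x ∷ xs) {i} lt with ℕₚ.m≤n⇒m<n∨m≡n (s≤s⁻¹ lt)
... | inj₁ i< = there (subst (_∈ xs) (sym (fromEnd-tail d x xs i<)) (fromEnd-∈ d xs i<))
... | inj₂ e = here (fromEnd-head d x xs e)

∈-fromEnd : {A : Set} (d : A) (xs : List A) {y : A} → y ∈ xs → ∃ λ i → i < length xs × fromEnd d xs i ≡ y
∈-fromEnd d (x ∷ xs) (here refl) = length xs , ℕₚ.n<1+n _ , fromEnd-head d x xs refl
∈-fromEnd d (x ∷ xs) (there m) with ∈-fromEnd d xs m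
... | i , i< , e = i , ℕₚ.m<n⇒m<1+n i< , trans (fromEnd-tail d x xs i<) e

module ProperSequences {n : ℕ} (π : Fin n → Fin n) (π-inj : IsPerm π) where
  open Plot π π-inj
  open PinSequences π π-inj

  initial : ∀ {p₁ p₂ T} → Proper p₁ p₂ T → ∀ d i → 1 ≤ i → i < length T →
    ∃ λ R → Proper p₁ p₂ (fromEnd d T i ∷ R) × length R ≡ i × (∀ j → j < i → fromEnd d T j ≡ fromEnd d R j)
  initial {p₁} {p₂} start d zero () _
  initial {p₁} {p₂} start d (suc zero) _ _ = p₁ ∷ [] , start , refl , λ j j< → fromEnd-tail d p₂ (p₁ ∷ []) j<
  initial start d (suc (suc i)) _ (s≤s (s≤s ()))
  initial {T = q ∷ p ∷ R} (extend sep pr) d i 1≤i i< with ℕₚ.m≤n⇒m<n∨m≡n (s≤s⁻¹ i<)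
  ... | inj₂ e = p ∷ R , subst (λ x → Proper _ _ (x ∷ p ∷ R)) (sym (fromEnd-head d q (p ∷ R) e)) (extend sep pr) , sym e ,
                 λ j j< → fromEnd-tail d q (p ∷ R) (subst (j <_) e j<)
  ... | inj₁ i<' with initial pr d i 1≤i i<'
  ...   | R' , pr' , l , agree = R' , subst (λ x → Proper _ _ (x ∷ R')) (sym (fromEnd-tail d q (p ∷ R) i<')) pr' , l ,
                 λ j j< → trans (fromEnd-tail d q (p ∷ R) (ℕₚ.<-trans j< i<')) (agree j j<)

  proper-truncate : ∀ {p₁ p₂ T m} → Proper p₁ p₂ T → 2 ≤ m → m ≤ length T → ∃ λ T' → Proper p₁ p₂ T' × length T' ≡ m
  proper-truncate {T = T} start 2≤m m≤ = T , start , ℕₚ.≤-antisym 2≤m m≤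
  proper-truncate {T = T} (extend sep pr) 2≤m m≤ with ℕₚ.m≤n⇒m<n∨m≡n m≤
  ... | inj₁ lt = proper-truncate pr 2≤m (s≤s⁻¹ lt)
  ... | inj₂ refl = T , extend sep pr , refl

  proper-distinct : ∀ {p₁ p₂ q R} → p₁ ≢ p₂ → Proper p₁ p₂ (q ∷ R) → All (_≢ q) R
  proper-distinct ne start = ne ∷ []
  proper-distinct ne (extend sep _) = All.map lt-≢ (SeparatingPin.beyond sep)

  module _ {p₁ p₂ : Fin n} {T : List (Fin n)} (p₁≢p₂ : p₁ ≢ p₂) (pr : Proper p₁ p₂ T) where

    private
      m : ℕ
      m = length T

      p : Fin m → Fin n
      p i = fromEnd p₁ T (toℕ i)

      Range : Axis → Fin m → Fin n → Set
      Range α i w = (∃ λ j → toℕ j < toℕ i × coord α (p j) ≤ coord α w) × (∃ λ j → toℕ j < toℕ i × coord α w ≤ coord α (p j))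

      record Before (i : Fin m) : Set where
        field
          points : List (Fin n)
          proper : Proper p₁ p₂ (p i ∷ points)
          length-points : length points ≡ toℕ i
          agree : ∀ j → j < toℕ i → fromEnd p₁ T j ≡ fromEnd p₁ points j

        earlier-∈ : ∀ {j} → toℕ j < toℕ i → p j ∈ points
        earlier-∈ {j} lt = subst (_∈ points) (sym (agree (toℕ j) lt))
          (fromEnd-∈ p₁ points (subst (toℕ j <_) (sym length-points) lt))

        ∈-earlier : ∀ {r} → r ∈ points → ∃ λ j → toℕ j < toℕ i × p j ≡ r
        ∈-earlier m∈ with ∈-fromEnd p₁ points m∈
        ... | j , j< , e = fromℕ< j<m , subst (_< toℕ i) (sym toℕ-j) j<i ,
                           trans (cong (fromEnd p₁ T) toℕ-j) (trans (agree j j<i) e)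
          where
          j<i = subst (j <_) length-points j<
          j<m = ℕₚ.<-trans j<i (Finₚ.toℕ<n i)
          toℕ-j = Finₚ.toℕ-fromℕ< j<m

      before : ∀ i → 1 ≤ toℕ i → Before i
      before i 1≤i with initial pr p₁ (toℕ i) 1≤i (Finₚ.toℕ<n i)
      ... | R , pr' , l , agree = record { points = R ; proper = pr' ; length-points = l ; agree = agree }

      injective : Injective _≡_ _≡_ p
      injective = separated⇒injective p λ i j i<j e →
        let b = before j (ℕₚ.≤-trans (s≤s z≤n) i<j) in
        All.lookup (proper-distinct p₁≢p₂ (Before.proper b)) (Before.earlier-∈ b i<j) e

      record Step (i : Fin m) : Set where
        field
          {axis} : Axis
          {sgn sgn'} : Bool
          {prev first} : Fin n
          {rest} : List (Fin n)
          prior : Before i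
          points-≡ : Before.points prior ≡ prev ∷ first ∷ rest
          separating : SeparatingPin axis sgn sgn' (p i) prev (first ∷ rest)

        open SeparatingPin separating public

        earlier : ∀ {j} → toℕ j < toℕ i → p j ∈ prev ∷ first ∷ rest
        earlier lt = subst (_ ∈_) points-≡ (Before.earlier-∈ prior lt)

        index : ∀ {r} → r ∈ prev ∷ first ∷ rest → ∃ λ j → toℕ j < toℕ i × p j ≡ r
        index m∈ = Before.∈-earlier prior (subst (_ ∈_) (sym points-≡) m∈)

      step : ∀ i → 2 ≤ toℕ i → Step i
      step i 2≤i = go (before i (ℕₚ.<⇒≤ 2≤i)) refl (Before.proper (before i (ℕₚ.<⇒≤ 2≤i))) refl
        where
        -- The head of the list becomes a variable `q`, since the computed term `p i` cannot be
        -- unified with the index of a constructor of `Proper`.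
        go : (b : Before i) → ∀ {R q} → Before.points b ≡ R → Proper p₁ p₂ (q ∷ R) → q ≡ p i → Step i
        go b e start e' = ⊥-elim (ℕₚ.<-irrefl (trans (cong length (sym e)) (Before.length-points b)) 2≤i)
        go b e (extend {R = []} sep (())) e'
        go b e (extend {R = r ∷ R} sep _) refl = record { prior = b ; points-≡ = e ; separating = sep }

      not-in-range : ∀ {α s i w} → (∀ {j} → toℕ j < toℕ i → Lt α s (p j) w) → ¬ Range α i w
      not-in-range f ((j , j< , le) , (j' , j'< , le')) = bad (f j<) (f j'<)
        where
        bad : ∀ {s} → Lt _ s (p j) _ → Lt _ s (p j') _ → ⊥
        bad _ (pos l) = ℕₚ.<⇒≱ l le'
        bad (neg l) _ = ℕₚ.<⇒≱ l le

      Band : Axis → Fin m → Fin n → Set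
      Band α i w = (∃ λ j → toℕ j < toℕ i × coord α (p j) < coord α w) × (∃ λ j → toℕ j < toℕ i × coord α w < coord α (p j))

      band : ∀ {i} (st : Step i) → Band (other (Step.axis st)) i (p i)
      band {i} st = make (index (here refl)) (index (there (here refl))) before' (All.head after)
        where
        open Step st renaming (before to before')
        make : ∀ {s' a b} → (∃ λ j → toℕ j < toℕ i × p j ≡ a) → (∃ λ j → toℕ j < toℕ i × p j ≡ b) →
          Lt (other axis) s' (p i) a → Lt (other axis) s' b (p i) → Band (other axis) i (p i)
        make (j , j< , refl) (j' , j'< , refl) (pos l) (pos l') = (j' , j'< , l') , (j , j< , l)
        make (j , j< , refl) (j' , j'< , refl) (neg l) (neg l') = (j , j< , l) , (j' , j'< , l')

      pin-condition : Pins.PinCondition π p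
      pin-condition i 2≤i with step i 2≤i
      ... | st with Step.axis st in eq
      ...   | horizontal = (λ (x , y) → not-in-range (λ lt → All.lookup (beyond' eq) (Step.earlier st lt)) x) ,
                           inj₂ (subst (λ α → Band (other α) i (p i)) eq (band st))
        where
        beyond' : ∀ {α} → Step.axis st ≡ α → All (λ r → Lt α (Step.sgn st) r (p i)) _
        beyond' refl = Step.beyond st
      ...   | vertical = (λ (x , y) → not-in-range (λ lt → All.lookup (beyond' eq) (Step.earlier st lt)) y) ,
                           inj₁ (subst (λ α → Band (other α) i (p i)) eq (band st))
        where
        beyond' : ∀ {α} → Step.axis st ≡ α → All (λ r → Lt α (Step.sgn st) r (p i)) _
        beyond' refl = Step.beyond st

      -- The direction in which `p i` lies beyond everything must be that of the pin: on the other
      -- axis `p i` is inside the band, and the opposite sign contradicts its place relative to the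
      -- previous point. The closed range becomes strict because `w`, farther out than `p i`, is
      -- none of the earlier points.
      maximal : ∀ i → 2 ≤ toℕ i → ∀ α s → (∀ j → toℕ j < toℕ i → Lt α s (p j) (p i)) →
        ∀ w → Lt α s (p i) w → ¬ Range (other α) i w
      maximal i 2≤i α s all w l range with step i 2≤i
      ... | st = bad α s (Step.axis st) (Step.sgn st) refl refl all l range
        where
        first-before : ∃ λ j → toℕ j < toℕ i × p j ≡ Step.prev st
        first-before = Step.index st (here refl)
        strict : ∀ {β t} → Lt β t (p i) w → (∀ {j} → toℕ j < toℕ i → Lt β t (p j) (p i)) →
          ∀ γ → Range γ i w → Within γ (Step.prev st ∷ Step.first st ∷ Step.rest st) w
        strict l all γ ((j , j< , le) , (j' , j'< , le')) =
          lose (Step.earlier st j<) (pos (ℕₚ.≤∧≢⇒< le λ e → lt-≢ (lt-trans (all j<) l) (coord-injective γ e))) ,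
          lose (Step.earlier st j'<) (pos (ℕₚ.≤∧≢⇒< le' λ e → lt-≢ (lt-trans (all j'<) l) (coord-injective γ (sym e))))
        crossing : ∀ γ s → Band γ i (p i) → (∀ j → toℕ j < toℕ i → Lt γ s (p j) (p i)) → ⊥
        crossing γ true (_ , j , j< , lt) all = ℕₚ.<-asym lt (unpos (all j j<))
        crossing γ false ((j , j< , lt) , _) all = ℕₚ.<-asym lt (unneg (all j j<))
        opposed : ∀ γ → Lt γ true (p (proj₁ first-before)) (p i) → Lt γ false (p (proj₁ first-before)) (p i) → ⊥
        opposed γ (pos l) (neg l') = ℕₚ.<-asym l l'
        beyond' : ∀ {β t} → Step.axis st ≡ β → Step.sgn st ≡ t → ∀ {j} → toℕ j < toℕ i → Lt β t (p j) (p i)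
        beyond' refl refl lt = All.lookup (Step.beyond st) (Step.earlier st lt)
        extreme' : ∀ {β t} → Step.axis st ≡ β → Step.sgn st ≡ t → ∀ w → Lt β t (p i) w →
          ¬ Within (other β) (Step.prev st ∷ Step.first st ∷ Step.rest st) w
        extreme' refl refl = Step.extreme st
        bad : ∀ α s β t → Step.axis st ≡ β → Step.sgn st ≡ t → (∀ j → toℕ j < toℕ i → Lt α s (p j) (p i)) →
          Lt α s (p i) w → Range (other α) i w → ⊥
        bad horizontal s vertical t e e' all l range = crossing horizontal s (subst (λ α → Band (other α) i (p i)) e (band st)) all
        bad vertical s horizontal t e e' all l range = crossing vertical s (subst (λ α → Band (other α) i (p i)) e (band st)) all
        bad horizontal true horizontal true e e' all l range = extreme' e e' w l (strict l (beyond' e e') vertical range)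
        bad horizontal false horizontal false e e' all l range = extreme' e e' w l (strict l (beyond' e e') vertical range)
        bad vertical true vertical true e e' all l range = extreme' e e' w l (strict l (beyond' e e') horizontal range)
        bad vertical false vertical false e e' all l range = extreme' e e' w l (strict l (beyond' e e') horizontal range)
        bad horizontal true horizontal false e e' all l range =
          opposed horizontal (all _ (proj₁ (proj₂ first-before))) (beyond' e e' (proj₁ (proj₂ first-before)))
        bad horizontal false horizontal true e e' all l range =
          opposed horizontal (beyond' e e' (proj₁ (proj₂ first-before))) (all _ (proj₁ (proj₂ first-before)))
        bad vertical true vertical false e e' all l range =
          opposed vertical (all _ (proj₁ (proj₂ first-before))) (beyond' e e' (proj₁ (proj₂ first-before)))
        bad vertical false vertical true e e' all l range =
          opposed vertical (beyond' e e' (proj₁ (proj₂ first-before))) (all _ (proj₁ (proj₂ first-before)))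

      maximality : Pins.Maximality π p
      maximality i 2≤i =
        (λ all q l → maximal i 2≤i horizontal true (λ j j< → pos (all j j<)) q (pos l)) ,
        (λ all q l → maximal i 2≤i horizontal false (λ j j< → neg (all j j<)) q (neg l)) ,
        (λ all q l → maximal i 2≤i vertical true (λ j j< → pos (all j j<)) q (pos l)) ,
        (λ all q l → maximal i 2≤i vertical false (λ j j< → neg (all j j<)) q (neg l))

      separation : Pins.Separation π p
      separation i i' 1≤i e = between (step i' (subst (2 ≤_) (sym e) (s≤s 1≤i)))
        where
        i<i' : toℕ i < toℕ i'
        i<i' = ℕₚ.≤-reflexive (sym e)
        between : Step i' → _
        between st = result axis sgn' before' (λ lt → All.lookup after (later lt))
          where
          open Step st renaming (before to before')
          length-rest : toℕ i ≡ length (first ∷ rest)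
          length-rest = ℕₚ.suc-injective (sym (trans (trans (cong length (sym points-≡)) (Before.length-points prior)) e))
          at : ∀ {j} → j < toℕ i' → fromEnd p₁ T j ≡ fromEnd p₁ (prev ∷ first ∷ rest) j
          at lt = trans (Before.agree prior _ lt) (cong (λ S → fromEnd p₁ S _) points-≡)
          prev-≡ : prev ≡ p i
          prev-≡ = sym (trans (at i<i') (fromEnd-head p₁ prev (first ∷ rest) length-rest))
          later : ∀ {j} → toℕ j < toℕ i → p j ∈ first ∷ rest
          later {j} lt = subst (_∈ first ∷ rest)
            (sym (trans (at (ℕₚ.<-trans lt i<i')) (fromEnd-tail p₁ prev (first ∷ rest) lt')))
            (fromEnd-∈ p₁ (first ∷ rest) lt')
            where
            lt' : toℕ j < length (first ∷ rest)
            lt' = subst (toℕ j <_) length-rest lt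
          result : ∀ α s → Lt (other α) s (p i') prev → (∀ {j} → toℕ j < toℕ i → Lt (other α) s (p j) (p i')) →
            Pins.BetweenH π p i (p i') ⊎ Pins.BetweenV π p i (p i')
          result vertical true b a = inj₁ (inj₁ ((λ j lt → unpos (a lt)) , unpos (subst (Lt _ _ _) prev-≡ b)))
          result vertical false b a = inj₁ (inj₂ ((λ j lt → unneg (a lt)) , unneg (subst (Lt _ _ _) prev-≡ b)))
          result horizontal true b a = inj₂ (inj₁ ((λ j lt → unpos (a lt)) , unpos (subst (Lt _ _ _) prev-≡ b)))
          result horizontal false b a = inj₂ (inj₂ ((λ j lt → unneg (a lt)) , unneg (subst (Lt _ _ _) prev-≡ b)))

    isProperPinSequence : HasProperPinSequence π (length T)
    isProperPinSequence = p , injective , pin-condition , maximality , separation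

  proper⇒pinSequence : ∀ {p₁ p₂ T m} → p₁ ≢ p₂ → Proper p₁ p₂ T → 2 ≤ m → m ≤ length T → HasProperPinSequence π m
  proper⇒pinSequence ne pr 2≤m m≤ with proper-truncate pr 2≤m m≤
  ... | T' , pr' , refl = isProperPinSequence ne pr'

-- Wedges

-- For arms of K + 1 points: the last one is replaced by the point that completes the wedge.
cap : {A : Set} → ℕ → (ℕ → A) → A → ℕ → A
cap K f x i with i ℕₚ.<? K
... | yes _ = f i
... | no _ = x

cap-< : {A : Set} (K : ℕ) (f : ℕ → A) (x : A) {i : ℕ} → i < K → cap K f x i ≡ f i
cap-< K f x {i} lt with i ℕₚ.<? K
... | yes _ = refl
... | no ¬lt = ⊥-elim (¬lt lt)

cap-≡ : {A : Set} (K : ℕ) (f : ℕ → A) (x : A) → cap K f x K ≡ x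
cap-≡ K f x with K ℕₚ.<? K
... | yes lt = ⊥-elim (ℕₚ.<-irrefl refl lt)
... | no _ = refl

prepend : {A : Set} → A → (ℕ → A) → ℕ → A
prepend x f zero = x
prepend x f (suc i) = f i

-- Four colours, and one more point than rungs: the last of the sorted points has no successor to
-- form a rung with.
forkBound : ℕ → ℕ
forkBound M = suc (ramsey 4 (4 * M))

module Wedges {n : ℕ} (π : Fin n → Fin n) (π-inj : IsPerm π) where
  open Plot π π-inj
  open Zigzags π π-inj

  -- The wedge is widest at index 0. Coming nearer to `x` along `α`, the arm `a` above it and the
  -- arm `c` below it approach its level.
  record Closing (α : Axis) (s s' : Bool) (M : ℕ) (x : Fin n) (a c : ℕ → Fin n) : Set where
    field
      zigzag : Zigzag α s M a c
      apex : ∀ i → i < M → Lt α s (c i) x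
      low : ∀ i → i < M → Lt (other α) s' (c i) x
      high : ∀ i → i < M → Lt (other α) s' x (a i)
      down : ∀ i j → i < j → j < M → Lt (other α) s' (a j) (a i)
      up : ∀ i j → i < j → j < M → Lt (other α) s' (c i) (c j)

    open Zigzag zigzag public

    a-mono : ∀ i j → i < j → j < M → Lt α s (c i) (a j)
    a-mono i (suc j) i<j j<M with ℕₚ.m≤n⇒m<n∨m≡n (s≤s⁻¹ i<j)
    ... | inj₂ refl = link j j<M
    ... | inj₁ i<j' = lt-trans (a-mono i j i<j' (ℕₚ.<-trans (ℕₚ.n<1+n j) j<M)) (lt-trans (rise j (ℕₚ.<-trans (ℕₚ.n<1+n j) j<M)) (link j j<M))

    c-mono : ∀ i j → i < j → j < M → Lt α s (c i) (c j)
    c-mono i j i<j j<M = lt-trans (a-mono i j i<j j<M) (rise j j<M)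

    split : ∀ i j → i < M → j < M → Lt (other α) s' (c j) (a i)
    split i j i<M j<M = lt-trans (low j j<M) (high i i<M)

    down-≤ : ∀ i j {z} → i ≤ j → j < M → Lt (other α) s' (a i) z → Lt (other α) s' (a j) z
    down-≤ i j le j<M l with ℕₚ.m≤n⇒m<n∨m≡n le
    ... | inj₁ lt = lt-trans (down i j lt j<M) l
    ... | inj₂ refl = l

    up-≤ : ∀ i j {z} → i ≤ j → j < M → Lt (other α) s' z (c i) → Lt (other α) s' z (c j)
    up-≤ i j le j<M l with ℕₚ.m≤n⇒m<n∨m≡n le
    ... | inj₁ lt = lt-trans l (up i j lt j<M)
    ... | inj₂ refl = l

  module Exits {α : Axis} {s s' : Bool} {M : ℕ} {x : Fin n} {a c : ℕ → Fin n} (closing : Closing α s s' M x a c)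
               {K : ℕ} (1≤K : 1 ≤ K) (t : ℕ) (t+k<M : t + suc K < M) where
    open Closing closing

    private
      k = suc K

      -- The patterns are read away from `x`, so the rungs from `t` to `t + k` are taken in
      -- decreasing order.
      ix : ℕ → ℕ
      ix i = t + k ∸ i

      ix<M : ∀ i → ix i < M
      ix<M i = ℕₚ.≤-<-trans (ℕₚ.m∸n≤m (t + k) i) t+k<M

      ix-suc : ∀ {i} → i < k → suc (ix (suc i)) ≡ ix i
      ix-suc {i} lt = sym (ℕₚ.+-∸-assoc 1 {t + k} {suc i} (ℕₚ.≤-trans lt (ℕₚ.m≤n+m k t)))

      t≤ix : ∀ {i} → i ≤ k → t ≤ ix i
      t≤ix {i} le = ℕₚ.≤-trans (ℕₚ.≤-reflexive (sym (ℕₚ.m+n∸n≡m t k))) (ℕₚ.∸-monoʳ-≤ (t + k) le)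

      ix-anti : ∀ {i j} → i < j → j ≤ k → ix j < ix i
      ix-anti lt le = ℕₚ.∸-monoʳ-< lt (ℕₚ.≤-trans le (ℕₚ.m≤n+m k t))

      link' : ∀ {i} → i < k → Lt α s (c (ix (suc i))) (a (ix i))
      link' {i} lt = subst (λ u → Lt α s (c (ix (suc i))) (a u)) (ix-suc lt)
        (link (ix (suc i)) (subst (_< M) (sym (ix-suc lt)) (ix<M i)))

    -- Along `α`, `q` has passed `k` rungs, but its level is still between the arms at rung `t + k`.
    -- Read away from `x`, the wedge opens towards `q`, which becomes the last entry of type 1.
    exit-side : ∀ q → Lt (other α) s' (c (t + k)) q → Lt (other α) s' q (a (t + k)) → Lt α s q (c t) → ContainsUnavoidable (2 * k)
    exit-side q c<q q<a q<c = basic-type1 s' zz K refl 1≤K sep up' down' apex'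
      where
      a' c₀ c' : ℕ → Fin n
      a' i = a (ix i)
      c₀ i = c (ix (suc i))
      c' = cap K c₀ q
      inner : ∀ {i} (P : Fin n → Set) → i < K → P (c₀ i) → P (c' i)
      inner P lt = subst P (sym (cap-< K c₀ q lt))
      final : ∀ (P : Fin n → Set) → P q → P (c' K)
      final P = subst P (sym (cap-≡ K c₀ q))
      every : ∀ {i} (P : Fin n → Set) → i < k → (i < K → P (c₀ i)) → P q → P (c' i)
      every P lt f g with ℕₚ.m≤n⇒m<n∨m≡n (s≤s⁻¹ lt)
      ... | inj₁ lt' = inner P lt' (f lt')
      ... | inj₂ refl = final P g
      q<a' : ∀ {i} → i < k → Lt (other α) s' q (a' i)
      q<a' {zero} lt = q<a
      q<a' {suc i} lt = lt-trans q<a (down (ix (suc i)) (t + k) (ix-anti (s≤s z≤n) (ℕₚ.<⇒≤ lt)) t+k<M)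
      zz : Zigzag α (not s) k a' c'
      zz = record
        { rise = λ i lt → every (Lt α (not s) (a' i)) lt (λ _ → lt-flip (link' lt)) (lt-flip (lt-trans q<c (a-mono t (ix i) (t<ix lt) (ix<M i))))
        ; link = λ i lt → inner (λ w → Lt α (not s) w (a' (suc i))) (s≤s⁻¹ lt) (lt-flip (rise (ix (suc i)) (ix<M (suc i)))) }
        where
        t<ix : ∀ {i} → i < k → t < ix i
        t<ix {i} lt = ℕₚ.≤-<-trans (t≤ix ℕₚ.≤-refl) (ix-anti lt ℕₚ.≤-refl)
      sep : ∀ i j → i < k → j < k → Lt (other α) s' (c' j) (a' i)
      sep i j i<k j<k = every (λ w → Lt (other α) s' w (a' i)) j<k (λ _ → split (ix i) (ix (suc j)) (ix<M i) (ix<M (suc j))) (q<a' i<k)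
      up' : ∀ i j → i < j → j < k → Lt (other α) s' (a' i) (a' j)
      up' i j i<j j<k = down (ix j) (ix i) (ix-anti i<j (ℕₚ.<⇒≤ j<k)) (ix<M i)
      down' : ∀ i j → i < j → j < K → Lt (other α) s' (c' j) (c' i)
      down' i j i<j j<K = subst₂ (Lt (other α) s') (sym (cap-< K c₀ q j<K)) (sym (cap-< K c₀ q (ℕₚ.<-trans i<j j<K)))
        (up (ix (suc j)) (ix (suc i)) (ix-anti (s≤s i<j) (s≤s (ℕₚ.<⇒≤ j<K))) (ix<M (suc i)))
      apex' : ∀ i → i < K → Lt (other α) s' (c' i) (c' K)
      apex' i i<K = inner (λ w → Lt (other α) s' w (c' K)) i<K (final (Lt (other α) s' (c₀ i))
        (lt-trans (up (ix (suc i)) (t + k) (ix-anti (s≤s z≤n) (s≤s (ℕₚ.<⇒≤ i<K))) t+k<M) c<q))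

    -- Read from `x` outwards: `x` in the middle, `z` on top, then the arms moving apart, `c`
    -- downwards and `a` upwards. This is type 2.
    exit-above : ∀ z → Lt α s (c (t + k)) z → Lt α s z x → Lt (other α) s' (a t) z → ContainsUnavoidable (2 * k)
    exit-above z c<z z<x a<z = basic-type2 s' zz (s≤s 1≤K) a<top c<top low' high' down' up'
      where
      a' c' : ℕ → Fin n
      a' = prepend x (c ∘ ix)
      c' = prepend z (a ∘ ix)
      a-top : ∀ {i} → i ≤ k → Lt (other α) s' (a (ix i)) z
      a-top {i} le = down-≤ t (ix i) (t≤ix le) (ix<M i) a<z
      x-top : Lt (other α) s' x z
      x-top = lt-trans (high (ix 0) (ix<M 0)) (a-top z≤n)
      zz : Zigzag α (not s) k a' c'
      zz = record { rise = r ; link = l }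
        where
        r : ∀ i → i < k → Lt α (not s) (a' i) (c' i)
        r zero lt = lt-flip z<x
        r (suc i) lt = lt-flip (rise (ix i) (ix<M i))
        l : ∀ i → suc i < k → Lt α (not s) (c' i) (a' (suc i))
        l zero lt = lt-flip c<z
        l (suc i) lt = lt-flip (link' (ℕₚ.<-trans (ℕₚ.n<1+n i) (ℕₚ.<-trans (ℕₚ.n<1+n (suc i)) lt)))
      a<top : ∀ i → i < k → Lt (other α) s' (a' i) z
      a<top zero lt = x-top
      a<top (suc i) lt = lt-trans (low (ix i) (ix<M i)) x-top
      c<top : ∀ i → 0 < i → i < k → Lt (other α) s' (c' i) z
      c<top (suc i) _ lt = a-top (ℕₚ.<⇒≤ (ℕₚ.<-trans (ℕₚ.n<1+n i) lt))
      low' : ∀ i → 0 < i → i < k → Lt (other α) s' (a' i) x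
      low' (suc i) _ lt = low (ix i) (ix<M i)
      high' : ∀ i → 0 < i → i < k → Lt (other α) s' x (c' i)
      high' (suc i) _ lt = high (ix i) (ix<M i)
      down' : ∀ i j → 0 < i → i < j → j < k → Lt (other α) s' (a' j) (a' i)
      down' (suc i) (suc j) _ i<j j<k = up (ix j) (ix i) (ix-anti (s≤s⁻¹ i<j) (ℕₚ.<⇒≤ (ℕₚ.<-trans (ℕₚ.n<1+n j) j<k))) (ix<M i)
      up' : ∀ i j → 0 < i → i < j → j < k → Lt (other α) s' (c' i) (c' j)
      up' (suc i) (suc j) _ i<j j<k = down (ix j) (ix i) (ix-anti (s≤s⁻¹ i<j) (ℕₚ.<⇒≤ (ℕₚ.<-trans (ℕₚ.n<1+n j) j<k))) (ix<M i)

    -- The previous case upside down, with the arms exchanged. Read outwards, `c (t + k)` would come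
    -- before `a (t + k)`, so it is skipped to let the arm `a` begin; this is the `suc` in `c'`.
    exit-below : ∀ z → Lt α s (c (t + k)) z → Lt α s z x → Lt (other α) s' z (c t) → ContainsUnavoidable (2 * k)
    exit-below z c<z z<x z<c = basic-type2 (not s') zz (s≤s 1≤K) a<top c<top low' high' down' up'
      where
      a' c' : ℕ → Fin n
      a' = prepend x (a ∘ ix)
      c' = prepend z (c ∘ ix ∘ suc)
      c-top : ∀ {i} → i ≤ k → Lt (other α) s' z (c (ix i))
      c-top {i} le = up-≤ t (ix i) (t≤ix le) (ix<M i) z<c
      x-top : Lt (other α) s' z x
      x-top = lt-trans (c-top z≤n) (low (ix 0) (ix<M 0))
      zz : Zigzag α (not s) k a' c'
      zz = record { rise = r ; link = l }
        where
        r : ∀ i → i < k → Lt α (not s) (a' i) (c' i)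
        r zero lt = lt-flip z<x
        r (suc i) lt = lt-flip (link' (ℕₚ.<-trans (ℕₚ.n<1+n i) lt))
        l : ∀ i → suc i < k → Lt α (not s) (c' i) (a' (suc i))
        l zero lt = lt-flip (lt-trans (rise (t + k) t+k<M) c<z)
        l (suc i) lt = lt-flip (rise (ix (suc i)) (ix<M (suc i)))
      a<top : ∀ i → i < k → Lt (other α) (not s') (a' i) z
      a<top zero lt = lt-flip x-top
      a<top (suc i) lt = lt-flip (lt-trans x-top (high (ix i) (ix<M i)))
      c<top : ∀ i → 0 < i → i < k → Lt (other α) (not s') (c' i) z
      c<top (suc i) _ lt = lt-flip (c-top (ℕₚ.<⇒≤ lt))
      low' : ∀ i → 0 < i → i < k → Lt (other α) (not s') (a' i) x
      low' (suc i) _ lt = lt-flip (high (ix i) (ix<M i))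
      high' : ∀ i → 0 < i → i < k → Lt (other α) (not s') x (c' i)
      high' (suc i) _ lt = lt-flip (low (ix (suc i)) (ix<M (suc i)))
      down' : ∀ i j → 0 < i → i < j → j < k → Lt (other α) (not s') (a' j) (a' i)
      down' (suc i) (suc j) _ i<j j<k = lt-flip (down (ix j) (ix i) (ix-anti (s≤s⁻¹ i<j) (ℕₚ.<⇒≤ (ℕₚ.<-trans (ℕₚ.n<1+n j) j<k))) (ix<M i))
      up' : ∀ i j → 0 < i → i < j → j < k → Lt (other α) (not s') (c' i) (c' j)
      up' (suc i) (suc j) _ i<j j<k = lt-flip (up (ix (suc j)) (ix (suc i)) (ix-anti i<j (ℕₚ.<⇒≤ j<k)) (ix<M (suc i)))

  -- Colour two pairs (a , c), (a' , c') by the relative heights of a, a' and of c, c'. A zigzag on which the colour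
  -- is constant is parallel or a wedge, and a wedge that opens towards x is completed by x.

  colours : List (Bool × Bool)
  colours = (true , true) ∷ (true , false) ∷ (false , true) ∷ (false , false) ∷ []

  colours-complete : ∀ b → b ∈ colours
  colours-complete (true , true) = here refl
  colours-complete (true , false) = there (here refl)
  colours-complete (false , true) = there (there (here refl))
  colours-complete (false , false) = there (there (there (here refl)))

  module _ (α : Axis) (s s' : Bool) (x : Fin n) (E : Fin n → Set) where

    private
      above : Fin n → Fin n → Bool
      above p q = does (lt? (other α) s' p q)

      above-true : ∀ {p q} → above p q ≡ true → Lt (other α) s' p q
      above-true {p} {q} e with lt? (other α) s' p q
      ... | yes l = l

      above-false : ∀ {p q} → p ≢ q → above p q ≡ false → Lt (other α) s' q p
      above-false {p} {q} ne e with lt? (other α) s' p q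
      above-false {p} {q} ne () | yes l
      ... | no ¬l with lt-connex (other α) s' p q ne
      ...   | inj₁ l = ⊥-elim (¬l l)
      ...   | inj₂ l = l

      -- `E` is whatever has to be known later about the points of a wedge; it passes through the
      -- selection untouched.
      Rung : Fin n × Fin n → Set
      Rung (a , c) = Lt α s a c × Lt α s c x × Lt (other α) s' c x × Lt (other α) s' x a × E a × E c

      Next : Fin n × Fin n → Fin n × Fin n → Set
      Next (_ , c) (a' , _) = Lt α s c a'

      colour : Fin n × Fin n → Fin n × Fin n → Bool × Bool
      colour (a , c) (a' , c') = above a a' , above c c'

    module _ (ys : List (Fin n)) (distinct : AllPairs _≢_ ys)
             (before-x : ∀ {y} → y ∈ ys → Lt α s y x) (above-x : ∀ {y} → y ∈ ys → Lt (other α) s' x y)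
             (E-ys : ∀ {y} → y ∈ ys → E y)
             (interlaced : ∀ {y y'} → y ∈ ys → y' ∈ ys → Lt α s y y' →
               ∃ λ c → Lt α s y c × Lt α s c y' × Lt (other α) s' c x × E c) where

      private
        -- Each point but the last is paired with one that interlacing puts before its successor.
        -- The last component carries comparisons over to all later rungs.
        rungs : ∀ z zs → AllPairs (Lt α s) (z ∷ zs) → (∀ {y} → y ∈ z ∷ zs → y ∈ ys) →
          ∃ λ ps → All Rung ps × AllPairs Next ps × length ps ≡ length zs × All (λ p → z ≡ proj₁ p ⊎ Lt α s z (proj₁ p)) ps
        rungs z [] _ _ = [] , [] , [] , refl , []
        rungs z (z' ∷ zs) ((z<z' ∷ _) ∷ sorted) inc with rungs z' zs sorted (inc ∘ there) | interlaced (inc (here refl)) (inc (there (here refl))) z<z'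
        ... | ps , good , next , len , from | c , z<c , c<z' , low , Ec =
          (z , c) ∷ ps ,
          (z<c , lt-trans c<z' (before-x (inc (there (here refl)))) , low , above-x (inc (here refl)) , E-ys (inc (here refl)) , Ec) ∷ good ,
          All.map (λ {p} → after {p = p} c<z') from ∷ next , cong suc len , inj₁ refl ∷ All.map (λ {p} → inj₂ ∘ after {p = p} z<z') from
          where
          after : ∀ {w} {p : Fin n × Fin n} → Lt α s w z' → z' ≡ proj₁ p ⊎ Lt α s z' (proj₁ p) → Lt α s w (proj₁ p)
          after l (inj₁ refl) = l
          after l (inj₂ l') = lt-trans l l'

      ClosingIn : ℕ → Set
      ClosingIn M = ∃₂ λ a c → Closing α s s' M x a c × (∀ i → i < M → E (a i)) × (∀ i → i < M → E (c i))

      fork : ∀ {K} M → 1 ≤ K → suc K ≤ M → forkBound M < length ys → ContainsUnavoidable (2 * suc K) ⊎ ClosingIn M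
      fork {K} M 1≤K k≤M lt with sort {_≺_ = Lt α s} lt-trans (lt-connex α s) ys distinct
      ... | [] , _ , len , _ = ⊥-elim (ℕₚ.n≮0 (subst (forkBound M <_) (sym len) lt))
      ... | z ∷ zs , sorted , len , inc with rungs z zs sorted inc
      ...   | ps , good , next , len' , _
        with homogeneous-sublist (≡-dec Boolₚ._≟_ Boolₚ._≟_) colours colours-complete colour M ps
               (ℕₚ.<-≤-trans (s≤s⁻¹ (subst (forkBound M <_) (sym len) lt)) (ℕₚ.≤-reflexive (sym len')))
      ...     | b , rs , sub , M< , mono = conclude b refl
        where
        k = suc K
        d : Fin n × Fin n
        d = x , x
        a c : ℕ → Fin n
        a i = proj₁ (nth d rs i)
        c i = proj₂ (nth d rs i)
        rung : ∀ {i} → i < M → Rung (nth d rs i)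
        rung i<M = All.lookup (All-resp-⊆ sub good) (nth-∈ d rs (ℕₚ.<-trans i<M M<))
        linked : ∀ {i j} → i < j → j < M → Lt α s (c i) (a j)
        linked i<j j<M = nth-AllPairs d (AllPairs-resp-⊆ sub next) i<j (ℕₚ.<-trans j<M M<)
        coloured : ∀ {i j} → i < j → j < M → colour (nth d rs i) (nth d rs j) ≡ b
        coloured i<j j<M = nth-AllPairs d mono i<j (ℕₚ.<-trans j<M M<)
        rise' : ∀ {i} → i < M → Lt α s (a i) (c i)
        rise' i<M = proj₁ (rung i<M)
        a-up : ∀ {b'} → b ≡ (true , b') → ∀ i j → i < j → j < M → Lt (other α) s' (a i) (a j)
        a-up e i j i<j j<M = above-true (cong proj₁ (trans (coloured i<j j<M) e))
        c-up : ∀ {b'} → b ≡ (b' , true) → ∀ i j → i < j → j < M → Lt (other α) s' (c i) (c j)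
        c-up e i j i<j j<M = above-true (cong proj₂ (trans (coloured i<j j<M) e))
        a-down : ∀ {b'} → b ≡ (false , b') → ∀ i j → i < j → j < M → Lt (other α) s' (a j) (a i)
        a-down e i j i<j j<M = above-false (lt-≢ (lt-trans (rise' (ℕₚ.<-trans i<j j<M)) (linked i<j j<M)))
          (cong proj₁ (trans (coloured i<j j<M) e))
        c-down : ∀ {b'} → b ≡ (b' , false) → ∀ i j → i < j → j < M → Lt (other α) s' (c j) (c i)
        c-down e i j i<j j<M = above-false (lt-≢ (lt-trans (linked i<j j<M) (rise' j<M)))
          (cong proj₂ (trans (coloured i<j j<M) e))
        to-M : ∀ {i} → i < k → i < M
        to-M i<k = ℕₚ.<-≤-trans i<k k≤M
        lows : ∀ {i} → i < M → Lt (other α) s' (c i) x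
        lows i<M = proj₁ (proj₂ (proj₂ (rung i<M)))
        highs : ∀ {i} → i < M → Lt (other α) s' x (a i)
        highs i<M = proj₁ (proj₂ (proj₂ (proj₂ (rung i<M))))
        zz : Zigzag α s M a c
        zz = record { rise = λ i → rise' ; link = λ i → linked (ℕₚ.n<1+n i) }
        zz-k : Zigzag α s k a c
        zz-k = record { rise = λ i i<k → rise' (to-M i<k) ; link = λ i i<k → linked (ℕₚ.n<1+n i) (to-M i<k) }
        sep : ∀ i j → i < k → j < k → Lt (other α) s' (c j) (a i)
        sep i j i<k j<k = lt-trans (lows (to-M j<k)) (highs (to-M i<k))
        -- In an opening wedge `x` takes the place of the last `c`: it is beyond all rungs and its
        -- level is between the arms.
        c' : ℕ → Fin n
        c' = cap K c x
        inner : ∀ {i} (P : Fin n → Set) → i < K → P (c i) → P (c' i)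
        inner P lt = subst P (sym (cap-< K c x lt))
        every : ∀ {i} (P : Fin n → Set) → i < k → P (c i) → P x → P (c' i)
        every P lt f g with ℕₚ.m≤n⇒m<n∨m≡n (s≤s⁻¹ lt)
        ... | inj₁ lt' = inner P lt' f
        ... | inj₂ refl = subst P (sym (cap-≡ K c x)) g
        zz-x : Zigzag α s k a c'
        zz-x = record
          { rise = λ i i<k → every (Lt α s (a i)) i<k (rise' (to-M i<k)) (lt-trans (rise' (to-M i<k)) (proj₁ (proj₂ (rung (to-M i<k)))))
          ; link = λ i i<k → inner (λ w → Lt α s w (a (suc i))) (s≤s⁻¹ i<k) (linked (ℕₚ.n<1+n i) (to-M i<k)) }
        conclude : ∀ b' → b ≡ b' → ContainsUnavoidable (2 * k) ⊎ ClosingIn M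
        conclude (true , true) e = inj₁ (parallel s' zz-k sep (inj₁
          ((λ i j i<j j<k → a-up e i j i<j (to-M j<k)) , (λ i j i<j j<k → c-up e i j i<j (to-M j<k)))))
        conclude (false , false) e = inj₁ (parallel s' zz-k sep (inj₂
          ((λ i j i<j j<k → a-down e i j i<j (to-M j<k)) , (λ i j i<j j<k → c-down e i j i<j (to-M j<k)))))
        conclude (true , false) e = inj₁ (basic-type1 s' zz-x K refl 1≤K
          (λ i j i<k j<k → every (λ w → Lt (other α) s' w (a i)) j<k (sep i j i<k j<k) (highs (to-M i<k)))
          (λ i j i<j j<k → a-up e i j i<j (to-M j<k))
          (λ i j i<j j<K → subst₂ (Lt (other α) s') (sym (cap-< K c x j<K)) (sym (cap-< K c x (ℕₚ.<-trans i<j j<K)))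
            (c-down e i j i<j (to-M (ℕₚ.m<n⇒m<1+n j<K))))
          (λ i i<K → inner (λ w → Lt (other α) s' w (c' K)) i<K
            (subst (Lt (other α) s' (c i)) (sym (cap-≡ K c x)) (lows (to-M (ℕₚ.m<n⇒m<1+n i<K))))))
        conclude (false , true) e = inj₂ (a , c , record
          { zigzag = zz
          ; apex = λ i i<M → proj₁ (proj₂ (rung i<M))
          ; low = λ i → lows
          ; high = λ i → highs
          ; down = a-down e
          ; up = c-up e } ,
          (λ i i<M → proj₁ (proj₂ (proj₂ (proj₂ (proj₂ (rung i<M)))))) ,
          (λ i i<M → proj₂ (proj₂ (proj₂ (proj₂ (proj₂ (rung i<M)))))))

-- A pin sequence leaving a closing wedge

axis-cases : ∀ α β → β ≡ α ⊎ (β ≡ other α × other β ≡ α)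
axis-cases horizontal horizontal = inj₁ refl
axis-cases horizontal vertical = inj₂ (refl , refl)
axis-cases vertical horizontal = inj₂ (refl , refl)
axis-cases vertical vertical = inj₁ refl

sign-cases : ∀ s b → b ≡ s ⊎ b ≡ not s
sign-cases true true = inj₁ refl
sign-cases true false = inj₂ refl
sign-cases false true = inj₂ refl
sign-cases false false = inj₁ refl

module Escape {n : ℕ} (π : Fin n → Fin n) (π-inj : IsPerm π) where
  open Plot π π-inj
  open PinSequences π π-inj
  open ProperSequences π π-inj
  open Wedges π π-inj

  Rightmost : Fin n → Set
  Rightmost x = ∀ p → p ≢ x → Lt horizontal true p x

  -- `q` lies between `r` and `p`, whichever way round, and keeps every bound that they share.
  above-both : ∀ {β b s u p q r} → Lt β b q p → Lt β b r q → Lt β s u p → Lt β s u r → Lt β s u q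
  above-both {b = b} {s} qp rq up ur with sign-cases s b
  ... | inj₁ refl = lt-trans ur rq
  ... | inj₂ refl = lt-trans up (lt-unflip qp)

  proper-second : ∀ {p₁ p₂ T} → Proper p₁ p₂ T → p₂ ∈ T
  proper-second start = here refl
  proper-second (extend _ pr) = there (proper-second pr)

  -- A pin sequence from the tip of a closing wedge to the leftmost point has fewer than 2k pins, so some pin
  -- crosses k rungs of the wedge at once.
  module _ {s' : Bool} {x : Fin n} {a c : ℕ → Fin n} {M : ℕ} (closing : Closing horizontal true s' (suc (suc M)) x a c)
           (rightmost : Rightmost x) {K : ℕ} (1≤K : 1 ≤ K) where
    open Closing closing

    private
      k = suc K

      -- The region that the wedge encloses on the tip side of rung `t`.
      Inside : ℕ → Fin n → Set
      Inside t u = Lt horizontal true (c t) u × Lt vertical s' u (a t) × Lt vertical s' (c t) u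

      inside-start : ∀ {t} → t ≤ M → All (Inside t) (x ∷ a (suc M) ∷ [])
      inside-start {t} t≤M =
        (apex t t< , high t t< , low t t<) ∷
        (a-mono t (suc M) (s≤s t≤M) (ℕₚ.n<1+n _) , down t (suc M) (s≤s t≤M) (ℕₚ.n<1+n _) , split (suc M) t (ℕₚ.n<1+n _) t<) ∷ []
        where
        t< : t < suc (suc M)
        t< = s≤s (ℕₚ.m≤n⇒m≤1+n t≤M)

      -- A left pin keeps to the heights of the deeper level and can leave only past `c t`. An up or
      -- down pin stays to the right of `c (t + k)` and can leave only across an arm. Either way it
      -- has passed `k` rungs, which is an exit. A right pin would be beyond the rightmost point.
      advance : ∀ t {β b b' q p R} → t + k ≤ M → x ∈ p ∷ R → SeparatingPin β b b' q p R → All (Inside (t + k)) (p ∷ R) →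
        0 < length R → All (Inside t) (q ∷ p ∷ R) ⊎ ContainsUnavoidable (2 * k)
      advance t {R = []} le x∈ sep ins ()
      advance t {β} {b} {b'} {q} {p} {r ∷ R} le x∈ sep ins@((cp , pa , cp') ∷ (cr , ra , cr') ∷ _) _ =
        go β b (All.lookup (SeparatingPin.beyond sep) x∈) (SeparatingPin.before sep) (All.head (SeparatingPin.after sep))
        where
        t+k< : t + k < suc (suc M)
        t+k< = s≤s (ℕₚ.m≤n⇒m≤1+n le)
        t< : t < t + k
        t< = ℕₚ.m<m+n t (s≤s z≤n)
        open Exits closing 1≤K t t+k<
        relax : ∀ {u} → Inside (t + k) u → Inside t u
        relax (l , h , l') = lt-trans (c-mono t _ t< t+k<) l , lt-trans h (down t _ t< t+k<) , lt-trans (up t _ t< t+k<) l'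
        q≢x : q ≢ x
        q≢x refl = lt-irrefl (All.lookup (SeparatingPin.beyond sep) x∈)
        conclude : Inside t q → All (Inside t) (q ∷ p ∷ r ∷ R)
        conclude i = i ∷ All.map relax ins
        go : ∀ β b → Lt β b x q → Lt (other β) b' q p → Lt (other β) b' r q → All (Inside t) (q ∷ p ∷ r ∷ R) ⊎ ContainsUnavoidable (2 * k)
        go horizontal true x<q _ _ = ⊥-elim (lt-asym x<q (rightmost q q≢x))
        go horizontal false _ before after with lt-compare horizontal true (c t) q
        ... | inj₁ refl = ⊥-elim (lt-asym (above-both before after cp' cr') (up t _ t< t+k<))
        ... | inj₂ (inj₁ c<q) = inj₁ (conclude (c<q , lt-trans (lt-unflip (above-both before after (lt-flip pa) (lt-flip ra))) (down t _ t< t+k<) ,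
                                     lt-trans (up t _ t< t+k<) (above-both before after cp' cr')))
        ... | inj₂ (inj₂ q<c) = inj₂ (exit-side q (above-both before after cp' cr') (lt-unflip (above-both before after (lt-flip pa) (lt-flip ra))) q<c)
        go vertical _ _ before after with above-both before after cp cr
        ... | cq with lt-connex vertical s' q (a t) (lt-≢ (lt-trans (a<c t+k<) cq) ∘ sym) | lt-connex vertical s' (c t) q (lt-≢ (lt-trans (c-mono t _ t< t+k<) cq))
          where
          a<c : t + k < suc (suc M) → Lt horizontal true (a t) (c (t + k))
          a<c lt = lt-trans (rise t (ℕₚ.<-trans t< lt)) (c-mono t _ t< lt)
        ...   | inj₂ a<q | _ = inj₂ (exit-above q cq (rightmost q q≢x) a<q)
        ...   | inj₁ _ | inj₂ q<c = inj₂ (exit-below q cq (rightmost q q≢x) q<c)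
        ...   | inj₁ q<a | inj₁ c<q = inj₁ (conclude (lt-trans (c-mono t _ t< t+k<) cq , q<a , c<q))

      -- A pin costs at most `k` rungs, so the older points are asked to lie `k` rungs deeper.
      levels : ∀ {U} → Proper (a (suc M)) x U → ∀ t → t + k * length U ≤ M → All (Inside t) U ⊎ ContainsUnavoidable (2 * k)
      levels start t le = inj₁ (inside-start (ℕₚ.≤-trans (ℕₚ.m≤m+n t _) le))
      levels (extend {q = q} {p} {R} sep pr) t le = next (levels pr (t + k) le')
        where
        le' : t + k + k * length (p ∷ R) ≤ M
        le' = ℕₚ.≤-trans (ℕₚ.≤-reflexive (trans (ℕₚ.+-assoc t k _) (cong (t +_) (sym (ℕₚ.*-suc k _))))) le
        next : _ → _
        next (inj₂ u) = inj₂ u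
        next (inj₁ ins) = advance t (ℕₚ.≤-trans (ℕₚ.m≤m+n (t + k) _) le') (proper-second pr) sep ins (proper-nonempty pr)

    escape : Simple π → k * (2 * k) ≤ M → HasProperPinSequence π (2 * k) ⊎ ContainsUnavoidable (2 * k)
    -- The starting pair is the innermost point of the arm `a` together with `x`; it lies inside
    -- every level up to `M`.
    escape simple le = by-length (reach simple tip≢x (inj₁ l≡0)
      (l-first (a-mono 0 (suc M) (s≤s z≤n) (ℕₚ.n<1+n _))) (l-first (apex 0 (s≤s z≤n))))
      where
      0<n : 0 < n
      0<n = ℕₚ.≤-<-trans z≤n (Finₚ.toℕ<n x)
      l : Fin n
      l = fromℕ< 0<n
      l≡0 : toℕ l ≡ 0
      l≡0 = Finₚ.toℕ-fromℕ< 0<n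
      l-first : ∀ {p u} → Lt horizontal true p u → l ≢ u
      l-first {p} (pos lt) refl = ℕₚ.n≮0 (subst (toℕ p <_) l≡0 lt)
      tip≢x : a (suc M) ≢ x
      tip≢x = lt-≢ (lt-trans (rise _ (ℕₚ.n<1+n _)) (apex _ (ℕₚ.n<1+n _)))
      by-length : (∃ λ T → Proper (a (suc M)) x (l ∷ T)) → _
      by-length (T , pr) with 2 * k ℕₚ.≤? length (l ∷ T)
      ... | yes long = inj₁ (proper⇒pinSequence tip≢x pr (ℕₚ.*-monoʳ-≤ 2 (s≤s z≤n)) long)
      ... | no short with levels pr 0 (ℕₚ.≤-trans (ℕₚ.*-monoʳ-≤ k (ℕₚ.<⇒≤ (ℕₚ.≰⇒> short))) le)
      ...   | inj₂ u = inj₂ u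
      ...   | inj₁ ((c<l , _) ∷ _) = ⊥-elim (l-first c<l refl)

-- Pin sequences converging at a common point

module Convergence {n : ℕ} (π : Fin n → Fin n) (π-inj : IsPerm π) where
  open Plot π π-inj
  open PinSequences π π-inj
  open Wedges π π-inj
  open Escape π π-inj

  opposed : ∀ {β b s x p q} → Lt β b p x → Lt β b q x → Lt β s x p → Lt β s q x → ⊥
  opposed {b = b} {s} px qx xp qx' with sign-cases s b
  ... | inj₁ refl = lt-asym px xp
  ... | inj₂ refl = lt-irrefl (lt-trans (lt-unflip qx) qx')

  SameSide : Axis → Fin n → Fin n → Fin n → Set
  SameSide α x z u = ∃ λ b → Lt α b x z × Lt α b u z

  -- Along the other axis `x` is between `y` and `r`, so nothing separates it from both there. The
  -- next pin must separate along `α`, where `x` is beyond all earlier points; so its own direction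
  -- is perpendicular to that of `x`.
  following-pin : ∀ {α s s' x y r t β b b' z} → SeparatingPin α s s' x y (r ∷ t) → SeparatingPin β b b' z x (y ∷ r ∷ t) →
    Lt α s z x × All (λ u → Lt α s u z × SameSide (other α) x z u) (y ∷ r ∷ t)
  following-pin {α} {s} {x = x} {y} {r} {t} {β} {b} {b'} {z} sep sep' with axis-cases α β
  ... | inj₁ refl = ⊥-elim (opposed (lt-trans (All.head S'.after) S'.before) (lt-trans (All.head (All.tail S'.after)) S'.before)
                                    S.before (All.head S.after))
    where
    module S = SeparatingPin sep
    module S' = SeparatingPin sep'
  ... | inj₂ (refl , e) = go b' e S'.before S'.after
    where
    module S = SeparatingPin sep
    module S' = SeparatingPin sep'
    go : ∀ {γ} b' → γ ≡ α → Lt γ b' z x → All (λ u → Lt γ b' u z) (y ∷ r ∷ t) →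
      Lt α s z x × All (λ u → Lt α s u z × SameSide (other α) x z u) (y ∷ r ∷ t)
    go b' refl before after with sign-cases s b'
    ... | inj₁ refl = before , All.zipWith (λ (l , l') → l , b , All.head S'.beyond , l') (after , All.tail S'.beyond)
    ... | inj₂ refl = ⊥-elim (lt-asym (All.head S.beyond) (lt-unflip (lt-trans (All.head after) before)))

  -- Since x lies between y and t in the other direction, y can only be a pin of that direction.
  previous-pin : ∀ {α s s' x y t β b b' w r} → t ≡ w ∷ r → 0 < length r → SeparatingPin α s s' x y t → SeparatingPin β b b' y w r →
    (Any (λ u → Lt α s y u) t) × (∀ u → Lt (other α) s' y u → ¬ Within α t u) × Within α t y
  previous-pin {r = []} refl () _ _
  previous-pin {α} {s} {s'} {β = β} {b} {b'} {w} {r₀ ∷ r} refl _ sep sep' with axis-cases α β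
  ... | inj₁ refl = ⊥-elim (lt-asym (lt-trans (All.head S.after) S.before) wrong)
    where
    module S = SeparatingPin sep
    module S' = SeparatingPin sep'
    wrong : Lt (other α) s' _ w
    wrong with sign-cases s' b'
    ... | inj₁ refl = S'.before
    ... | inj₂ refl = ⊥-elim (lt-asym (lt-trans (All.head (All.tail S.after)) S.before) (lt-unflip (All.head S'.after)))
  ... | inj₂ (refl , e) = go b b' e S'.before S'.after S'.extreme (All.head S'.beyond) (lt-trans (All.head S.after) S.before)
    where
    module S = SeparatingPin sep
    module S' = SeparatingPin sep'
    go : ∀ {γ} b b' {y} → γ ≡ α → Lt γ b' y w → All (λ u → Lt γ b' u y) (r₀ ∷ r) → (∀ u → Lt (other α) b y u → ¬ Within γ (w ∷ r₀ ∷ r) u) →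
      Lt (other α) b w y → Lt (other α) s' w y →
      Any (λ u → Lt α s y u) (w ∷ r₀ ∷ r) × (∀ u → Lt (other α) s' y u → ¬ Within α (w ∷ r₀ ∷ r) u) × Within α (w ∷ r₀ ∷ r) y
    go b b' {y} refl before after extreme w<y w<'y with sign-cases s' b
    ... | inj₂ refl = ⊥-elim (lt-asym w<'y (lt-unflip w<y))
    ... | inj₁ refl = ahead , extreme , within
      where
      -- As `y` is between `w` and `r₀` along `α`, one of them is ahead of it in either direction.
      ahead : Any (λ u → Lt α s y u) (w ∷ r₀ ∷ r)
      ahead with sign-cases s b'
      ... | inj₁ refl = here before
      ... | inj₂ refl = there (here (lt-unflip (All.head after)))
      within : Within α (w ∷ r₀ ∷ r) y
      within with sign-cases true b'
      ... | inj₁ refl = there (here (All.head after)) , here before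
      ... | inj₂ refl = here (lt-flip before) , there (here (lt-flip (All.head after)))

  -- A point of `t` ahead of `y` cannot stop short of `y'`, so it encloses `y'` on the far side; on
  -- the near side the bound for `y` serves.
  within-between : ∀ {α s t y y'} → Any (λ u → Lt α s y u) t → ¬ Any (λ u → Lt α s y u × Lt α s u y') t →
    All (_≢ y') t → Lt α s y y' → Within α t y → Within α t y'
  within-between {α} {s} {t} {y} {y'} ahead none ne y<y' (lo , hi) with find ahead
  ... | u , u∈ , y<u with lt-connex α s u y' (All.lookup ne u∈)
  ...   | inj₁ u<y' = ⊥-elim (none (lose u∈ (y<u , u<y')))
  ...   | inj₂ y'<u = orient s y<y' y'<u
    where
    orient : ∀ s → Lt α s y y' → Lt α s y' u → Within α t y'
    orient true l l' = Any.map (λ m → lt-trans m l) lo , lose u∈ l'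
    orient false l l' = lose u∈ (lt-flip l') , Any.map (λ m → lt-trans (lt-flip l) m) hi

  module _ {N : ℕ} (p₁ p₂ : Fin N → Fin n) (adjacent : ∀ j → toℕ (p₂ j) ≡ suc (toℕ (p₁ j))) where

    adjacent-between : ∀ {s} i {x} → Lt horizontal s x (p₂ i) → Lt horizontal s (p₁ i) x → ⊥
    adjacent-between i {x} (pos l) (pos l') = ℕₚ.<⇒≱ (subst (toℕ x <_) (adjacent i) l) l'
    adjacent-between i (neg l) (neg l') = ℕₚ.<-asym (ℕₚ.<-trans l l') (subst (toℕ (p₁ i) <_) (sym (adjacent i)) (ℕₚ.n<1+n _))

    -- Without a point between y and y', each of them would lie in the band of which the other is the extreme pin.
    interlace : ∀ {α s s' x} i j {y y' t t'} → SeparatingPin α s s' x y t → SeparatingPin α s s' x y' t' →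
      Proper (p₁ i) (p₂ i) (y ∷ t) → Proper (p₁ j) (p₂ j) (y' ∷ t') → length t ≡ length t' → Lt α s y y' →
      ∃ λ c → (c ∈ t ⊎ c ∈ t') × Lt α s y c × Lt α s c y'
    -- A vertical pin would have to lie between two adjacent positions.
    interlace {vertical} i j sep _ start start _ _ =
      ⊥-elim (adjacent-between i (SeparatingPin.before sep) (All.head (SeparatingPin.after sep)))
    -- `p₁ j` is the left neighbour of `p₂ j`; it is not `p₂ i`, because these two are on opposite
    -- sides of `x` vertically.
    interlace {horizontal} {true} {s'} i j sep sep' start start _ (pos l) =
      p₁ j , inj₂ (here refl) , pos (ℕₚ.≤∧≢⇒< (s≤s⁻¹ (subst (toℕ (p₂ i) <_) (adjacent j) l)) λ e → apart (Finₚ.toℕ-injective e)) ,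
      pos (ℕₚ.≤-reflexive (sym (adjacent j)))
      where
      apart : p₂ i ≢ p₁ j
      apart e = lt-≢ (lt-trans (All.head (SeparatingPin.after sep')) (SeparatingPin.before sep)) (sym e)
    interlace {horizontal} {false} {s'} i j sep sep' start start _ (neg l) =
      p₁ i , inj₁ (here refl) , neg (ℕₚ.≤-reflexive (sym (adjacent i))) ,
      neg (ℕₚ.≤∧≢⇒< (s≤s⁻¹ (subst (toℕ (p₂ j) <_) (adjacent i) l)) λ e → apart (Finₚ.toℕ-injective e))
      where
      apart : p₂ j ≢ p₁ i
      apart e = lt-≢ (lt-trans (All.head (SeparatingPin.after sep)) (SeparatingPin.before sep')) (sym e)
    interlace i j sep sep' start (extend _ pr') e _ = ⊥-elim (ℕₚ.<-irrefl (ℕₚ.suc-injective e) (proper-nonempty pr'))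
    interlace i j sep sep' (extend _ pr) start e _ = ⊥-elim (ℕₚ.<-irrefl (sym (ℕₚ.suc-injective e)) (proper-nonempty pr))
    interlace {α} {s} {s'} {x} i j {y} {y'} {t} {t'} sep sep' (extend sp pr) (extend sp' pr') e l
      with Any.any? (λ u → lt? α s y u ×-dec lt? α s u y') t | Any.any? (λ u → lt? α s y u ×-dec lt? α s u y') t'
    ... | yes a | _ = let (c , m , between) = find a in c , inj₁ m , between
    ... | no _ | yes a = let (c , m , between) = find a in c , inj₂ m , between
    ... | no none | no none'
      with previous-pin refl (proper-nonempty pr) sep sp | previous-pin refl (proper-nonempty pr') sep' sp'
    ...   | ahead , top , wi | _ , top' , wi' = ⊥-elim (contradiction' (lt-connex (other α) s' y y' (lt-≢ l)))
      where
      module S = SeparatingPin sep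
      module S' = SeparatingPin sep'
      behind : Any (λ u → Lt α (not s) y' u) t'
      behind = either wi' s
        where
        either : Within α t' y' → ∀ s → Any (λ u → Lt α (not s) y' u) t'
        either (lo , hi) true = Any.map lt-flip lo
        either (lo , hi) false = hi
      contradiction' : Lt (other α) s' y y' ⊎ Lt (other α) s' y' y → ⊥
      contradiction' (inj₁ y<y') = top y' y<y'
        (within-between ahead none (All.map (λ u<x e → lt-≢ (lt-trans u<x S'.before) e) S.after) l wi)
      contradiction' (inj₂ y'<y) = top' y y'<y
        (within-between behind (none' ∘ Any.map λ (a , b) → lt-unflip b , lt-unflip a)
          (All.map (λ u<x e → lt-≢ (lt-trans u<x S.before) e) S'.after) (lt-flip l) wi')

-- The tree of pin sequences read backwards

orientations : List (Axis × Bool × Bool)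
orientations =
  (horizontal , true , true) ∷ (horizontal , true , false) ∷ (horizontal , false , true) ∷ (horizontal , false , false) ∷
  (vertical , true , true) ∷ (vertical , true , false) ∷ (vertical , false , true) ∷ (vertical , false , false) ∷ []

orientations-complete : ∀ o → o ∈ orientations
orientations-complete (horizontal , true , true) = here refl
orientations-complete (horizontal , true , false) = there (here refl)
orientations-complete (horizontal , false , true) = there (there (here refl))
orientations-complete (horizontal , false , false) = there (there (there (here refl)))
orientations-complete (vertical , true , true) = there (there (there (there (here refl))))
orientations-complete (vertical , true , false) = there (there (there (there (there (here refl)))))
orientations-complete (vertical , false , true) = there (there (there (there (there (there (here refl))))))
orientations-complete (vertical , false , false) = there (there (there (there (there (there (there (here refl)))))))

module Branching {n : ℕ} (π : Fin n → Fin n) (π-inj : IsPerm π) (simple : Simple π) {N : ℕ}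
                 (p₁ p₂ : Fin N → Fin n) (adjacent : ∀ j → toℕ (p₂ j) ≡ suc (toℕ (p₁ j)))
                 (p₁-injective : ∀ {i j} → p₁ i ≡ p₁ j → i ≡ j) {K : ℕ} (1≤K : 1 ≤ K)
                 {M₀ F B : ℕ} (M₀-large : suc K * (2 * suc K) ≤ M₀) (F-large : forkBound (suc (suc M₀)) ≤ F) (B-large : 8 * F < B) where
  open Plot π π-inj
  open PinSequences π π-inj
  open ProperSequences π π-inj
  open Wedges π π-inj
  open Escape π π-inj
  open Convergence π π-inj

  private
    k M : ℕ
    k = suc K
    M = suc (suc M₀)

    k≤M₀ : k ≤ M₀
    k≤M₀ = ℕₚ.≤-trans (ℕₚ.m≤m*n k (2 * k)) M₀-large

    1<B : 1 < B
    1<B = ℕₚ.≤-<-trans (ℕₚ.≤-trans (ℕₚ.≤-trans (s≤s z≤n) F-large) (ℕₚ.m≤n*m F 8)) B-large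

  Outcome : Set
  Outcome = HasProperPinSequence π (2 * k) ⊎ ContainsUnavoidable (2 * k)

  p₁≢p₂ : ∀ j → p₁ j ≢ p₂ j
  p₁≢p₂ j e = ℕₚ.1+n≢n (trans (sym (adjacent j)) (cong toℕ (sym e)))

  p₂-injective : ∀ {i j} → p₂ i ≡ p₂ j → i ≡ j
  p₂-injective {i} {j} e = p₁-injective (Finₚ.toℕ-injective (ℕₚ.suc-injective (trans (sym (adjacent i)) (trans (cong toℕ e) (adjacent j)))))

  -- What follows the point at which sequences converge: nothing, or their common next pin.
  data Context : Set where
    root : Context
    next : Fin n → Context

  Valid : Context → Fin n → Fin N → List (Fin n) → Set
  Valid root x j T = Rightmost x
  Valid (next z) x j T = Proper (p₁ j) (p₂ j) (z ∷ x ∷ T)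

  record Branch (κ : Context) (x : Fin n) (d : ℕ) : Set where
    field
      index : Fin N
      points : List (Fin n)
      length-points : length points ≡ d
      proper : Proper (p₁ index) (p₂ index) (x ∷ points)
      valid : Valid κ x index points

    second : Fin n
    second = nth x points 0

  open Branch

  Oriented : Axis × Bool × Bool → Fin n → Fin n → List (Fin n) → Set
  Oriented (α , s , s') = SeparatingPin α s s'

  last-separation : ∀ {κ x d} (b : Branch κ x (suc (suc d))) → ∃ λ o → ∃₂ λ y t →
    points b ≡ y ∷ t × Oriented o x y t × Proper (p₁ (index b)) (p₂ (index b)) (y ∷ t)
  last-separation b = go (length-points b) (proper b)
    where
    go : ∀ {x d T} → length T ≡ suc (suc d) → Proper _ _ (x ∷ T) → ∃ λ o → ∃₂ λ y t → T ≡ y ∷ t × Oriented o x y t × Proper _ _ (y ∷ t)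
    go () start
    go e (extend {p = y} {R = t} sep pr) = _ , y , t , refl , sep , pr

  -- What `following-pin` tells about the earlier points; it is the property `E` handed to `fork`.
  Enclosed : Context → Axis → Bool → Fin n → Fin n → Set
  Enclosed root α s x u = Rightmost x
  Enclosed (next z) α s x u = Lt α s z x × Lt α s u z × SameSide (other α) x z u

  -- At the root only a wedge to the left of `x` is possible. Otherwise the next pin `z` stands
  -- between the wedge and `x` along `α` and is beyond both along the other axis, so it exits above
  -- or below.
  resolve : ∀ κ {α s s' x a c} → Closing α s s' M x a c →
    (∀ i → i < M → Enclosed κ α s x (a i)) → (∀ i → i < M → Enclosed κ α s x (c i)) → Outcome
  resolve root {α} {s} closing Ea Ec = go α s closing (Ea 0 (s≤s z≤n))
    where
    go : ∀ α s {s' x a c} → Closing α s s' M x a c → Rightmost x → Outcome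
    go horizontal true closing rm = escape closing rm 1≤K simple M₀-large
    go horizontal false closing rm with Closing.apex closing 0 (s≤s z≤n)
    ... | l = ⊥-elim (lt-asym (lt-flip l) (rm _ (lt-≢ l)))
    go vertical s {true} closing rm with Closing.high closing 0 (s≤s z≤n)
    ... | l = ⊥-elim (lt-asym l (rm _ (lt-≢ l ∘ sym)))
    go vertical s {false} closing rm with Closing.low closing 0 (s≤s z≤n)
    ... | l = ⊥-elim (lt-asym (lt-flip l) (rm _ (lt-≢ l)))
  resolve (next z) {α} {s} {s'} {x} {a} {c} closing Ea Ec = inj₂ (go (proj₂ (proj₂ (Ea 0 (s≤s z≤n)))) (proj₂ (proj₂ (Ec 0 (s≤s z≤n)))))
    where
    k<M : k < M
    k<M = s≤s (ℕₚ.m≤n⇒m≤1+n k≤M₀)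
    open Exits closing 1≤K 0 k<M
    z<x : Lt α s z x
    z<x = proj₁ (Ea 0 (s≤s z≤n))
    c<z : Lt α s (c k) z
    c<z = proj₁ (proj₂ (Ec k k<M))
    go : SameSide (other α) x z (a 0) → SameSide (other α) x z (c 0) → ContainsUnavoidable (2 * k)
    go (b , x<z , a<z) (b' , x<'z , c<z') with sign-cases s' b | sign-cases s' b'
    ... | inj₁ refl | _ = exit-above z c<z z<x a<z
    ... | inj₂ refl | inj₂ refl = exit-below z c<z z<x (lt-unflip c<z')
    ... | inj₂ refl | inj₁ refl = ⊥-elim (lt-asym x<'z (lt-unflip x<z))

  merge : ∀ {κ x d} (bs : List (Branch κ x (suc (suc d)))) → AllPairs (λ b b' → second b ≢ second b') bs →
    B ≤ length bs → Outcome
  merge {κ} {x} {d} bs distinct B≤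
    -- One of eight orientations of `x` is fixed here, which is the purpose of `8 * F < B`.
    with constant-sublist (≡-dec _≟ᵃ_ (≡-dec Boolₚ._≟_ Boolₚ._≟_)) (proj₁ ∘ last-separation) orientations F bs
           (All.universal (orientations-complete ∘ proj₁ ∘ last-separation) bs) (ℕₚ.<-≤-trans B-large B≤)
  ... | (α , s , s') , cs , sub , same , lt = conclude (fork α s s' x (Enclosed κ α s x) ys
          (AllPairsₚ.map⁺ (AllPairs-resp-⊆ sub distinct)) before-x above-x (All.head ∘ enclosed ∘ converging) interlaced
          M 1≤K k≤M (ℕₚ.≤-<-trans F-large (subst (F <_) (sym (length-map second cs)) lt)))
    where
    k≤M : k ≤ M
    k≤M = ℕₚ.m≤n⇒m≤1+n (ℕₚ.m≤n⇒m≤1+n k≤M₀)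
    ys : List (Fin n)
    ys = map second cs
    record Converging (y : Fin n) : Set where
      constructor conv
      field
        {j} : Fin N
        {t} : List (Fin n)
        length-t : length t ≡ suc d
        separating : SeparatingPin α s s' x y t
        earlier : Proper (p₁ j) (p₂ j) (y ∷ t)
        following : Valid κ x j (y ∷ t)
    open Converging
    converging : ∀ {y} → y ∈ ys → Converging y
    converging m with ∈-map⁻ second m
    ... | b , b∈ , refl with last-separation b | All.lookup same b∈ | length-points b | valid b
    ...   | _ , y , t , e , sep , pr | refl | len | v =
      subst Converging (cong (λ T → nth x T 0) (sym e))
        (conv (ℕₚ.suc-injective (trans (cong length (sym e)) len)) sep pr (subst (Valid κ x (index b)) e v))
    before-x : ∀ {y} → y ∈ ys → Lt α s y x
    before-x m = All.head (SeparatingPin.beyond (separating (converging m)))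
    above-x : ∀ {y} → y ∈ ys → Lt (other α) s' x y
    above-x m = SeparatingPin.before (separating (converging m))
    enclosed : ∀ {y} (v : Converging y) → All (Enclosed κ α s x) (y ∷ t v)
    enclosed v = go κ (length-t v) (separating v) (following v)
      where
      go : ∀ κ {y T j} → length T ≡ suc d → SeparatingPin α s s' x y T → Valid κ x j (y ∷ T) → All (Enclosed κ α s x) (y ∷ T)
      go root len sep rm = All.universal (λ _ → rm) _
      go (next z) {T = r ∷ T} len sep (extend sep' _) with following-pin sep sep'
      ... | z<x , rest = All.map (z<x ,_) rest
    interlaced : ∀ {y y'} → y ∈ ys → y' ∈ ys → Lt α s y y' →
      ∃ λ c → Lt α s y c × Lt α s c y' × Lt (other α) s' c x × Enclosed κ α s x c
    interlaced m m' l with converging m | converging m'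
    ... | v | v' with interlace p₁ p₂ adjacent (j v) (j v') (separating v) (separating v') (earlier v) (earlier v')
                        (trans (length-t v) (sym (length-t v'))) l
    ...   | c , inj₁ c∈ , y<c , c<y' = c , y<c , c<y' , All.lookup (SeparatingPin.after (separating v)) c∈ , All.lookup (enclosed v) (there c∈)
    ...   | c , inj₂ c∈ , y<c , c<y' = c , y<c , c<y' , All.lookup (SeparatingPin.after (separating v')) c∈ , All.lookup (enclosed v') (there c∈)
    conclude : ContainsUnavoidable (2 * k) ⊎ _ → Outcome
    conclude (inj₁ u) = inj₂ u
    conclude (inj₂ (a , c , closing , Ea , Ec)) = resolve κ closing Ea Ec

  first-two : ∀ {A : Set} {R : A → A → Set} {xs} → 1 < length xs → AllPairs R xs → ∃₂ λ a b → R a b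
  first-two {xs = a ∷ b ∷ _} _ ((r ∷ _) ∷ _) = a , b , r
  first-two {xs = a ∷ []} (s≤s ()) _

  initial-branch : ∀ {κ x} (b : Branch κ x 1) → x ≡ p₂ (index b) × second b ≡ p₁ (index b)
  initial-branch b = go (length-points b) (proper b)
    where
    go : ∀ {x T j} → length T ≡ 1 → Proper (p₁ j) (p₂ j) (x ∷ T) → x ≡ p₂ j × nth x T 0 ≡ p₁ j
    go e start = refl , refl
    go e (extend _ pr) = ⊥-elim (ℕₚ.<-irrefl (sym (ℕₚ.suc-injective e)) (proper-nonempty pr))

  -- Either `B` branches have pairwise different predecessors of `x`, or more than a `B`th part of
  -- the guaranteed number share one, and the descent goes on there with `x` as the next pin.
  descend : ∀ d κ x (bs : List (Branch κ x (suc d))) → AllPairs _≢_ (map index bs) → B ^ suc d < length bs → Outcome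
  -- At the bottom `x` and its predecessor are the starting pair itself, so either of them
  -- determines the index and two different branches cannot meet.
  descend zero κ x bs distinct lt with distinct-or-constant-sublist Finₚ._≟_ second B 1 bs lt
  ... | inj₁ (cs , sub , ne , e) with first-two (subst (1 <_) e 1<B) ne
  ...   | b , b' , ne' = ⊥-elim (ne' (trans (proj₂ (initial-branch b)) (trans
           (cong p₁ (p₂-injective (trans (sym (proj₁ (initial-branch b))) (proj₁ (initial-branch b'))))) (sym (proj₂ (initial-branch b'))))))
  descend zero κ x bs distinct lt | inj₂ (y , cs , sub , same , 1<)
    with cs | sub | same | 1<
  ... | b ∷ b' ∷ _ | sub' | e ∷ e' ∷ _ | _ =
    ⊥-elim (All.head (AllPairs.head (AllPairs-resp-⊆ (⊆-map⁺ index sub') distinct))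
      (p₁-injective (trans (sym (proj₂ (initial-branch b))) (trans (trans e (sym e')) (proj₂ (initial-branch b'))))))
  ... | b ∷ [] | _ | _ | s≤s ()
  descend (suc d) κ x bs distinct lt with distinct-or-constant-sublist Finₚ._≟_ second B (B ^ suc d) bs lt
  ... | inj₁ (cs , sub , ne , e) = merge cs ne (ℕₚ.≤-reflexive e)
  ... | inj₂ (y , cs , sub , same , lt') with shorten cs same
    where
    shorten₁ : ∀ (b : Branch κ x (suc (suc d))) → second b ≡ y → ∃ λ (b' : Branch (next x) y (suc d)) → index b' ≡ index b
    shorten₁ b e with last-separation b | length-points b | proper b
    ... | _ , y' , t , e' , _ , pr | len | pr' with trans (sym (cong (λ T → nth x T 0) e')) e
    ...   | refl = record
      { index = index b ; points = t
      ; length-points = ℕₚ.suc-injective (trans (cong length (sym e')) len)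
      ; proper = pr
      ; valid = subst (λ T → Proper _ _ (x ∷ T)) e' pr' } , refl
    shorten : ∀ cs → All (λ b → second b ≡ y) cs →
      ∃ λ (bs' : List (Branch (next x) y (suc d))) → map index bs' ≡ map index cs × length bs' ≡ length cs
    shorten [] [] = [] , refl , refl
    shorten (b ∷ cs) (e ∷ es) with shorten₁ b e | shorten cs es
    ... | b' , i | bs' , is , l = b' ∷ bs' , cong₂ _∷_ i is , cong suc l
  ...   | bs' , is , l = descend d (next x) y bs'
    (subst (AllPairs _≢_) (sym is) (AllPairs-resp-⊆ (⊆-map⁺ index sub) distinct)) (subst (B ^ suc d <_) (sym l) lt')

  module _ {r : Fin n} (rightmost : Rightmost r) (tail : Fin N → List (Fin n))
           (tail-proper : ∀ j → Proper (p₁ j) (p₂ j) (r ∷ tail j)) where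

    private
      branches : ∀ d js → All (λ j → length (tail j) ≡ d) js → ∃ λ (bs : List (Branch root r d)) → map index bs ≡ js
      branches d [] [] = [] , refl
      branches d (j ∷ js) (e ∷ es) with branches d js es
      ... | bs , is = record { index = j ; points = tail j ; length-points = e ; proper = tail-proper j ; valid = rightmost } ∷ bs , cong (j ∷_) is

    converge : 2 * k * B ^ (2 * k) < N → Outcome
    converge lt = by-length (Finₚ.any? λ j → 2 * k ℕₚ.≤? length (r ∷ tail j))
      where
      by-length : Dec (∃ λ j → 2 * k ≤ length (r ∷ tail j)) → Outcome
      by-length (yes (j , long)) = inj₁ (proper⇒pinSequence (p₁≢p₂ j) (tail-proper j) (ℕₚ.*-monoʳ-≤ 2 (s≤s z≤n)) long)
      by-length (no short)
        -- All tails are shorter than `2 * k`; one frequent length is chosen, which aligns the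
        -- branches.
        with constant-sublist ℕₚ._≟_ (length ∘ tail) (upTo (2 * k)) (B ^ (2 * k)) (allFin N)
               (All.universal (λ j → ∈-upTo⁺ (ℕₚ.<⇒≤ (short< j))) (allFin N))
               (subst₂ (λ a b → a * B ^ (2 * k) < b) (sym (length-applyUpTo id (2 * k))) (sym (length-tabulate id)) lt)
        where
        short< : ∀ j → suc (length (tail j)) < 2 * k
        short< j = ℕₚ.≰⇒> λ le → short (j , le)
      ... | d , js , sub , same , lt' = go d js same sub lt'
        where
        d≤ : ∀ {d j} → length (tail j) ≡ d → d ≤ 2 * k
        d≤ {j = j} refl = ℕₚ.<⇒≤ (ℕₚ.≰⇒> λ le → short (j , ℕₚ.m≤n⇒m≤1+n le))
        go : ∀ d js → All (λ j → length (tail j) ≡ d) js → js ⊆ allFin N → B ^ (2 * k) < length js → Outcome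
        go zero (j ∷ js) (e ∷ _) _ _ = ⊥-elim (ℕₚ.<-irrefl (sym e) (proper-nonempty (tail-proper j)))
        go (suc d) js@(_ ∷ _) es@(e ∷ _) sub lt' with branches (suc d) js es
        ... | bs , is = descend d root r bs
          (subst (AllPairs _≢_) (sym is) (AllPairs-resp-⊆ sub (allFin⁺ N)))
          (ℕₚ.≤-<-trans (ℕₚ.^-monoʳ-≤ B {{ℕ.>-nonZero (ℕₚ.<⇒≤ 1<B)}} (d≤ e)) (subst (B ^ (2 * k) <_) (trans (cong length (sym is)) (length-map index bs)) lt'))

  converge-at-rightmost : ∀ r → suc (toℕ r) ≡ n → (∀ j → r ≢ p₁ j) → (∀ j → r ≢ p₂ j) → 2 * k * B ^ (2 * k) < N → Outcome
  converge-at-rightmost r r-last r≢p₁ r≢p₂ =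
    converge rightmost (proj₁ ∘ pins) (proj₂ ∘ pins)
    where
    pins : ∀ j → ∃ λ T → Proper (p₁ j) (p₂ j) (r ∷ T)
    pins j = reach simple (p₁≢p₂ j) (inj₂ r-last) (r≢p₁ j) (r≢p₂ j)
    rightmost : Rightmost r
    rightmost p ne = pos (ℕₚ.≤∧≢⇒< (s≤s⁻¹ (subst (toℕ p <_) (sym r-last) (Finₚ.toℕ<n p))) (ne ∘ Finₚ.toℕ-injective))

-- Estimates for the bound

suc-ramsey≤8^ : ∀ t → suc (ramsey 4 t) ≤ 8 ^ t
suc-ramsey≤8^ zero = ℕₚ.≤-refl
suc-ramsey≤8^ (suc t) = begin
  2 + 4 * R     ≤⟨ ℕₚ.+-monoˡ-≤ (4 * R) (s≤s (s≤s (z≤n {2}))) ⟩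
  4 + 4 * R     ≡⟨ ℕₚ.*-suc 4 R ⟨
  4 * suc R     ≤⟨ ℕₚ.*-monoʳ-≤ 4 (suc-ramsey≤8^ t) ⟩
  4 * 8 ^ t     ≤⟨ ℕₚ.*-monoˡ-≤ (8 ^ t) (ℕₚ.m≤m+n 4 4) ⟩
  8 * 8 ^ t     ∎
  where
  open ℕₚ.≤-Reasoning
  R = ramsey 4 t

m≤2^m : ∀ m → m ≤ 2 ^ m
m≤2^m zero = z≤n
m≤2^m (suc m) = begin
  1 + m         ≤⟨ ℕₚ.+-mono-≤ (ℕₚ.m^n>0 2 m) (m≤2^m m) ⟩
  2 ^ m + 2 ^ m ≡⟨ cong (2 ^ m +_) (ℕₚ.+-identityʳ (2 ^ m)) ⟨
  2 * 2 ^ m     ∎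
  where open ℕₚ.≤-Reasoning

module Bounds (k : ℕ) (1≤k : 1 ≤ k) where

  -- `F` is 8 to the power 4 (M₀ + 2), written with base 2, and dominates `forkBound`. `B` is 16 F,
  -- above the 8 F that the orientations require. `N` exceeds the product of 2k lengths and
  -- `B ^ (2 * k)` branches.
  M₀ e F B N Q : ℕ
  M₀ = k * (2 * k)
  e = 3 * (4 * suc (suc M₀))
  F = 2 ^ e
  B = 2 ^ (4 + e)
  N = suc (2 * k * B ^ (2 * k))
  Q = 2048 * k ^ 8

  F-large : forkBound (suc (suc M₀)) ≤ F
  F-large = ℕₚ.≤-trans (suc-ramsey≤8^ (4 * suc (suc M₀))) (ℕₚ.≤-reflexive (ℕₚ.^-*-assoc 2 3 (4 * suc (suc M₀))))

  B-large : 8 * F < B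
  B-large = subst (8 * F <_) (sym (ℕₚ.^-distribˡ-+-* 2 4 e))
    (ℕₚ.*-monoˡ-< F {{ℕₚ.m^n≢0 2 e}} {8} {16} (ℕₚ.m≤m+n 9 7))

  instance
    k≢0 : ℕ.NonZero k
    k≢0 = ℕ.>-nonZero 1≤k

    Q≢0 : ℕ.NonZero Q
    Q≢0 = ℕₚ.m*n≢0 2048 (k ^ 8) {{_}} {{ℕₚ.m^n≢0 k 8}}

  exponent : ℕ
  exponent = 2 + (2 * k + (4 + e) * (2 * k))

  -- Cubic in k: the depth 2k times a number of rungs quadratic in k.
  exponent-≡ : exponent ≡ 2 + 58 * k ^ 1 + 48 * k ^ 3
  exponent-≡ = solve 1 (λ k →
      con 2 :+ (con 2 :* k :+ (con 4 :+ con 3 :* (con 4 :* (con 2 :+ k :* (con 2 :* k)))) :* (con 2 :* k))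
      := con 2 :+ con 58 :* k :^ 1 :+ con 48 :* k :^ 3) refl k
    where open +-*-Solver

  exponent≤Q : exponent ≤ Q
  exponent≤Q = begin
    exponent                                ≡⟨ exponent-≡ ⟩
    2 + 58 * k ^ 1 + 48 * k ^ 3             ≤⟨ ℕₚ.+-mono-≤ (ℕₚ.+-mono-≤ (ℕₚ.*-monoʳ-≤ 2 (ℕₚ.m^n>0 k 8)) (ℕₚ.*-monoʳ-≤ 58 (power 1 (ℕₚ.m≤m+n 1 7))))
                                                        (ℕₚ.*-monoʳ-≤ 48 (power 3 (ℕₚ.m≤m+n 3 5))) ⟩
    2 * k ^ 8 + 58 * k ^ 8 + 48 * k ^ 8     ≡⟨ cong (_+ 48 * k ^ 8) (ℕₚ.*-distribʳ-+ (k ^ 8) 2 58) ⟨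
    60 * k ^ 8 + 48 * k ^ 8                 ≡⟨ ℕₚ.*-distribʳ-+ (k ^ 8) 60 48 ⟨
    108 * k ^ 8                             ≤⟨ ℕₚ.*-monoˡ-≤ (k ^ 8) (ℕₚ.m≤m+n 108 1940) ⟩
    Q                                       ∎
    where
    open ℕₚ.≤-Reasoning
    power : ∀ i → i ≤ 8 → k ^ i ≤ k ^ 8
    power i le = ℕₚ.^-monoʳ-≤ k le

  Q≤Q^2k : Q ≤ Q ^ (2 * k)
  Q≤Q^2k = ℕₚ.≤-trans (ℕₚ.≤-reflexive (sym (ℕₚ.^-identityʳ Q))) (ℕₚ.^-monoʳ-≤ Q (ℕₚ.≤-trans 1≤k (ℕₚ.m≤n*m k 2)))

  2≤Q : 2 ≤ Q
  2≤Q = ℕₚ.≤-trans (ℕₚ.m≤m+n 2 2046) (ℕₚ.m≤m*n 2048 (k ^ 8) {{ℕₚ.m^n≢0 k 8}})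

  N<Q^Q^2k : N < Q ^ (Q ^ (2 * k))
  N<Q^Q^2k = begin
    2 + 2 * k * B ^ (2 * k)                   ≤⟨ ℕₚ.+-monoʳ-≤ 2 (ℕₚ.*-mono-≤ (m≤2^m (2 * k)) (ℕₚ.≤-reflexive (ℕₚ.^-*-assoc 2 (4 + e) (2 * k)))) ⟩
    2 + 2 ^ (2 * k) * 2 ^ ((4 + e) * (2 * k)) ≡⟨ cong (2 +_) (ℕₚ.^-distribˡ-+-* 2 (2 * k) ((4 + e) * (2 * k))) ⟨
    2 + 2 ^ y                                 ≤⟨ ℕₚ.+-monoˡ-≤ (2 ^ y) (ℕₚ.*-monoʳ-≤ 2 (ℕₚ.m^n>0 2 y)) ⟩
    2 * 2 ^ y + 2 ^ y                         ≡⟨ ℕₚ.+-comm (2 * 2 ^ y) (2 ^ y) ⟩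
    3 * 2 ^ y                                 ≤⟨ ℕₚ.*-monoˡ-≤ (2 ^ y) (ℕₚ.n≤1+n 3) ⟩
    4 * 2 ^ y                                 ≡⟨ ℕₚ.^-distribˡ-+-* 2 2 y ⟨
    2 ^ exponent                              ≤⟨ ℕₚ.^-monoˡ-≤ exponent 2≤Q ⟩
    Q ^ exponent                              ≤⟨ ℕₚ.^-monoʳ-≤ Q (ℕₚ.≤-trans exponent≤Q Q≤Q^2k) ⟩
    Q ^ (Q ^ (2 * k))                         ∎
    where
    open ℕₚ.≤-Reasoning
    y = 2 * k + (4 + e) * (2 * k)

  2N<bound : 2 * N < bound k
  2N<bound = ℕₚ.*-monoʳ-< 2 N<Q^Q^2k

-- Choice of the pairs, and conclusion

consecutive-pairs : ∀ {n} (π : Fin n → Fin n) (π-inj : IsPerm π) → Simple π → ∀ {K} → 1 ≤ K → ∀ {M₀ F B N} →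
  suc K * (2 * suc K) ≤ M₀ → forkBound (suc (suc M₀)) ≤ F → 8 * F < B → 2 * suc K * B ^ (2 * suc K) < N → 2 * N < n →
  HasProperPinSequence π (2 * suc K) ⊎ Plot.ContainsUnavoidable π π-inj (2 * suc K)
consecutive-pairs {suc n} π π-inj simple 1≤K {N = N} M₀-large F-large B-large N-large 2N≤n =
  -- The pairs occupy indices below `2 * N`, and `2 * N ≤ n` keeps the last index `n` free for the
  -- common end.
  Branching.converge-at-rightmost π π-inj simple p₁ p₂ adjacent p₁-injective 1≤K M₀-large F-large B-large
    (fromℕ n) (cong suc (Finₚ.toℕ-fromℕ n)) (apart p₁ p₁<n) (apart p₂ p₂<n) N-large
  where
  second<n : ∀ (j : Fin N) → suc (2 * toℕ j) < n
  second<n j = ℕₚ.≤-trans (ℕₚ.≤-reflexive (sym (2*suc (toℕ j)))) (ℕₚ.≤-trans (ℕₚ.*-monoʳ-≤ 2 (Finₚ.toℕ<n j)) (s≤s⁻¹ 2N≤n))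
  p₁ p₂ : Fin N → Fin (suc n)
  p₁ j = fromℕ< (ℕₚ.m<n⇒m<1+n (ℕₚ.<⇒≤ (second<n j)))
  p₂ j = fromℕ< (ℕₚ.m<n⇒m<1+n (second<n j))
  toℕ-p₁ : ∀ j → toℕ (p₁ j) ≡ 2 * toℕ j
  toℕ-p₁ j = Finₚ.toℕ-fromℕ< (ℕₚ.m<n⇒m<1+n (ℕₚ.<⇒≤ (second<n j)))
  toℕ-p₂ : ∀ j → toℕ (p₂ j) ≡ suc (2 * toℕ j)
  toℕ-p₂ j = Finₚ.toℕ-fromℕ< (ℕₚ.m<n⇒m<1+n (second<n j))
  adjacent : ∀ j → toℕ (p₂ j) ≡ suc (toℕ (p₁ j))
  adjacent j = trans (toℕ-p₂ j) (cong suc (sym (toℕ-p₁ j)))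
  p₁-injective : ∀ {i j} → p₁ i ≡ p₁ j → i ≡ j
  p₁-injective {i} {j} e = Finₚ.toℕ-injective (ℕₚ.*-cancelˡ-≡ (toℕ i) (toℕ j) 2
    (trans (sym (toℕ-p₁ i)) (trans (cong toℕ e) (toℕ-p₁ j))))
  p₁<n : ∀ j → toℕ (p₁ j) < n
  p₁<n j = subst (_< n) (sym (toℕ-p₁ j)) (ℕₚ.<⇒≤ (second<n j))
  p₂<n : ∀ j → toℕ (p₂ j) < n
  p₂<n j = subst (_< n) (sym (toℕ-p₂ j)) (second<n j)
  apart : ∀ (p : Fin N → Fin (suc n)) → (∀ j → toℕ (p j) < n) → ∀ j → fromℕ n ≢ p j
  apart p lt j e = ℕₚ.<-irrefl (trans (cong toℕ (sym e)) (Finₚ.toℕ-fromℕ n)) (lt j)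

pinSequence-2 : ∀ {n} (π : Fin n → Fin n) → IsPerm π → 2 ≤ n → HasProperPinSequence π 2
pinSequence-2 {suc (suc n)} π π-inj _ =
  ProperSequences.proper⇒pinSequence π π-inj {p₁ = Fin.zero} {p₂ = Fin.suc Fin.zero} (λ ()) PinSequences.start ℕₚ.≤-refl ℕₚ.≤-refl
pinSequence-2 {suc zero} π π-inj (s≤s ())

theorem4p5 : (k : ℕ) → 1 ≤ k → (n : ℕ) → (π : Fin n → Fin n) → IsPerm π → Simple π →
    bound k ≤ n →
    HasProperPinSequence π (2 * k)
    ⊎ (∃ λ (σ : Fin (2 * k) → Fin (2 * k)) → IsPerm σ × ParallelAlternation σ × Contains π σ)
    ⊎ (∃ λ (σ : Fin (2 * k) → Fin (2 * k)) → IsPerm σ × WedgeSimple σ × Contains π σ)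
theorem4p5 k 1≤k n π π-inj simple bound≤n = by-size k 1≤k refl
  where
  open Bounds k 1≤k
  2N<n : 2 * N < n
  2N<n = ℕₚ.<-≤-trans 2N<bound bound≤n
  2≤n : 2 ≤ n
  2≤n = ℕₚ.≤-trans (ℕₚ.*-monoʳ-≤ 2 (s≤s z≤n)) (ℕₚ.<⇒≤ 2N<n)
  Claim : ℕ → Set
  Claim l = HasProperPinSequence π (2 * l) ⊎ Plot.ContainsUnavoidable π π-inj (2 * l)
  by-size : ∀ l → 1 ≤ l → k ≡ l → Claim k
  -- Wedge simple permutations have length at least 4, so k = 1 is settled separately, by two points
  -- that form a proper pin sequence.
  by-size (suc zero) _ e = subst Claim (sym e) (inj₁ (pinSequence-2 π π-inj 2≤n))
  by-size (suc (suc K)) _ refl =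
    consecutive-pairs π π-inj simple (s≤s z≤n) ℕₚ.≤-refl F-large B-large (ℕₚ.n<1+n _) 2N<n
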